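{- The theory $V^0(2)$ proves (the natural $\Sigma^B_0$-formalization of) the following statement, for all $n$: Let $B$ be a set of grid edges forming a curve, let $p_1,p_2$ be two grid points on different sides of $B$, and let $R$ be a set of grid edges that connects $p_1$ and $p_2$. Then $B$ and $R$ intersect.
   Context: Grid setting: fix a parameter $n$. A grid point is a pair $(x,y)$ of integers with $0\le x,y\le n$; write $x(p),y(p)$ for its coordinates. A (undirected) edge is a pair of adjacent grid points, i.e. points differing by exactly 1 in exactly one coordinate. For a set $E$ of edges, the $E$-degree of a point $p$ is the number of edges of $E$ incident to $p$. A curve is a nonempty set $E$ of edges such that every grid point has $E$-degree $0$ or $2$ (so it may consist of several disjoint closed curves). A set $E$ of edges connects points $p_1,p_2$ if $p_1$ and $p_2$ have $E$-degree 1 and every other grid point has $E$-degree $0$ or $2$. Two sets $E_1,E_2$ of edges intersect if some grid point has $E_1$-degree $\ge1$ and $E_2$-degree $\ge1$. Points $p_1,p_2$ are on different sides of $E$ if $x(p_1)=x(p_2)$, $|y(p_1)-y(p_2)|=2$, $p_1$ and $p_2$ have $E$-degree $0$, and the point $p$ with $x(p)=x(p_1)$, $y(p)=\frac12(y(p_1)+y(p_2))$ has $E$-degree $2$. Theories: $V^0$ is the two-sorted first-order theory (sorts: natural numbers, and finite subsets of $\mathbb N$ viewed as bit strings) over the vocabulary $0,1,+,\cdot,\le,=,|X|,\in$ (where $|X|$ is one plus the largest element of $X$, or $0$ if $X=\emptyset$), axiomatized by the basic axioms of these symbols (2-BASIC) together with the comprehension scheme $\exists X\le y\,\forall z<y\,(X(z)\leftrightarrow\varphi(z))$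 for every $\Sigma^B_0$ formula $\varphi$ not containing $X$ ($\Sigma^B_0$ formulas: all number quantifiers bounded, no set quantifiers). $V^0(2)$ is $V^0$ plus the axiom $\exists Y\,[\neg Y(0)\wedge\forall z<x\,(Y(z+1)\leftrightarrow (Y(z)\oplus X(z)))]$ (existence of parity vectors). Points and edges are coded as numbers via a pairing function, and sets of edges as finite sets of numbers. -}

module Defs where

open import Data.Nat using (ℕ; zero; suc)
open import Data.List using (List; []; _∷_; map)
open import Data.List.Membership.Propositional using (_∈_)

-- Syntax of the two-sorted language of V^0 (de Bruijn indices).
-- Number variables:  var i.   Set variables: natural-number indices.
-- Set terms of the two-sorted vocabulary are just set variables.

infixl 7 _⊗_
infixl 6 _⊕_

data Tm : Set where
  var : ℕ → Tm
  zer one : Tm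
  _⊕_ _⊗_ : Tm → Tm → Tm
  len : ℕ → Tm

infix  4 _≐_ _≼_ _≐₂_ _<'_
infixr 3 _xor_
infixr 3 _∧'_
infixr 2 _∨'_
infixr 1 _⇒_ _⇔_

data Fm : Set where
  _≐_ _≼_ : Tm → Tm → Fm
  mem     : Tm → ℕ → Fm
  _≐₂_    : ℕ → ℕ → Fm
  ⊥'      : Fm
  _⇒_ _∧'_ _∨'_ : Fm → Fm → Fm
  ∀₁ ∃₁ ∀₂ ∃₂ : Fm → Fm

¬' : Fm → Fm
¬' φ = φ ⇒ ⊥'

_⇔_ : Fm → Fm → Fm
φ ⇔ ψ = (φ ⇒ ψ) ∧' (ψ ⇒ φ)

renTm₂ : (ℕ → ℕ) → Tm → Tm
renTm₂ ρ (var i) = var i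
renTm₂ ρ zer = zer
renTm₂ ρ one = one
renTm₂ ρ (s ⊕ t) = renTm₂ ρ s ⊕ renTm₂ ρ t
renTm₂ ρ (s ⊗ t) = renTm₂ ρ s ⊗ renTm₂ ρ t
renTm₂ ρ (len i) = len (ρ i)

subTm : (ℕ → Tm) → Tm → Tm
subTm σ (var i) = σ i
subTm σ zer = zer
subTm σ one = one
subTm σ (s ⊕ t) = subTm σ s ⊕ subTm σ t
subTm σ (s ⊗ t) = subTm σ s ⊗ subTm σ t
subTm σ (len i) = len i

↑ : Tm → Tm
↑ = subTm (λ i → var (suc i))

lift₁ : (ℕ → Tm) → ℕ → Tm
lift₁ σ zero = var zero
lift₁ σ (suc i) = ↑ (σ i)

liftR : (ℕ → ℕ) → ℕ → ℕ
liftR ρ zero = zero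
liftR ρ (suc i) = suc (ρ i)

subFm : (ℕ → Tm) → Fm → Fm
subFm σ (s ≐ t) = subTm σ s ≐ subTm σ t
subFm σ (s ≼ t) = subTm σ s ≼ subTm σ t
subFm σ (mem t i) = mem (subTm σ t) i
subFm σ (i ≐₂ j) = i ≐₂ j
subFm σ ⊥' = ⊥'
subFm σ (φ ⇒ ψ) = subFm σ φ ⇒ subFm σ ψ
subFm σ (φ ∧' ψ) = subFm σ φ ∧' subFm σ ψ
subFm σ (φ ∨' ψ) = subFm σ φ ∨' subFm σ ψ
subFm σ (∀₁ φ) = ∀₁ (subFm (lift₁ σ) φ)
subFm σ (∃₁ φ) = ∃₁ (subFm (lift₁ σ) φ)
subFm σ (∀₂ φ) = ∀₂ (subFm (λ i → renTm₂ suc (σ i)) φ)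
subFm σ (∃₂ φ) = ∃₂ (subFm (λ i → renTm₂ suc (σ i)) φ)

renFm₂ : (ℕ → ℕ) → Fm → Fm
renFm₂ ρ (s ≐ t) = renTm₂ ρ s ≐ renTm₂ ρ t
renFm₂ ρ (s ≼ t) = renTm₂ ρ s ≼ renTm₂ ρ t
renFm₂ ρ (mem t i) = mem (renTm₂ ρ t) (ρ i)
renFm₂ ρ (i ≐₂ j) = ρ i ≐₂ ρ j
renFm₂ ρ ⊥' = ⊥'
renFm₂ ρ (φ ⇒ ψ) = renFm₂ ρ φ ⇒ renFm₂ ρ ψ
renFm₂ ρ (φ ∧' ψ) = renFm₂ ρ φ ∧' renFm₂ ρ ψ
renFm₂ ρ (φ ∨' ψ) = renFm₂ ρ φ ∨' renFm₂ ρ ψ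
renFm₂ ρ (∀₁ φ) = ∀₁ (renFm₂ ρ φ)
renFm₂ ρ (∃₁ φ) = ∃₁ (renFm₂ ρ φ)
renFm₂ ρ (∀₂ φ) = ∀₂ (renFm₂ (liftR ρ) φ)
renFm₂ ρ (∃₂ φ) = ∃₂ (renFm₂ (liftR ρ) φ)

↑₁ : Fm → Fm
↑₁ = subFm (λ i → var (suc i))

↑₂ : Fm → Fm
↑₂ = renFm₂ suc

inst₁ : Tm → ℕ → Tm
inst₁ t zero = t
inst₁ t (suc i) = var i

sub₁ : Tm → Fm → Fm
sub₁ t = subFm (inst₁ t)

inst₂ : ℕ → ℕ → ℕ
inst₂ j zero = j
inst₂ j (suc i) = i

sub₂ : ℕ → Fm → Fm
sub₂ j = renFm₂ (inst₂ j)

_<'_ : Tm → Tm → Fm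
s <' t = (s ≼ t) ∧' ¬' (s ≐ t)

two : Tm
two = one ⊕ one

∀≤ : Tm → Fm → Fm
∀≤ t φ = ∀₁ ((var 0 ≼ ↑ t) ⇒ φ)

∃≤ : Tm → Fm → Fm
∃≤ t φ = ∃₁ ((var 0 ≼ ↑ t) ∧' φ)

∀<' : Tm → Fm → Fm
∀<' t φ = ∀≤ t (¬' (var 0 ≐ ↑ t) ⇒ φ)

_xor_ : Fm → Fm → Fm
φ xor ψ = (φ ∧' ¬' ψ) ∨' (¬' φ ∧' ψ)

data ΣB₀ : Fm → Set where
  eq   : ∀ s t → ΣB₀ (s ≐ t)
  le   : ∀ s t → ΣB₀ (s ≼ t)
  mm   : ∀ t i → ΣB₀ (mem t i)
  eq₂  : ∀ i j → ΣB₀ (i ≐₂ j)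
  bot  : ΣB₀ ⊥'
  imp  : ∀ {φ ψ} → ΣB₀ φ → ΣB₀ ψ → ΣB₀ (φ ⇒ ψ)
  conj : ∀ {φ ψ} → ΣB₀ φ → ΣB₀ ψ → ΣB₀ (φ ∧' ψ)
  disj : ∀ {φ ψ} → ΣB₀ φ → ΣB₀ ψ → ΣB₀ (φ ∨' ψ)
  ball : ∀ t {φ} → ΣB₀ φ → ΣB₀ (∀≤ t φ)
  bex  : ∀ t {φ} → ΣB₀ φ → ΣB₀ (∃≤ t φ)

-- Axioms of V^0(2).  Open axioms are read as universally closed
-- (the calculus below has ∀-introduction).
-- x = var 0, y = var 1, X = set 0, Y = set 1.

private
  x y : Tm
  x = var 0
  y = var 1

data AxV⁰2 : Fm → Set where
  B1  : AxV⁰2 (¬' (x ⊕ one ≐ zer))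
  B2  : AxV⁰2 ((x ⊕ one ≐ y ⊕ one) ⇒ (x ≐ y))
  B3  : AxV⁰2 (x ⊕ zer ≐ x)
  B4  : AxV⁰2 (x ⊕ (y ⊕ one) ≐ (x ⊕ y) ⊕ one)
  B5  : AxV⁰2 (x ⊗ zer ≐ zer)
  B6  : AxV⁰2 (x ⊗ (y ⊕ one) ≐ (x ⊗ y) ⊕ x)
  B7  : AxV⁰2 (((x ≼ y) ∧' (y ≼ x)) ⇒ (x ≐ y))
  B8  : AxV⁰2 (x ≼ x ⊕ y)
  B9  : AxV⁰2 (zer ≼ x)
  B10 : AxV⁰2 ((x ≼ y) ∨' (y ≼ x))
  B11 : AxV⁰2 ((x ≼ y) ⇔ (x <' y ⊕ one))
  B12 : AxV⁰2 (¬' (x ≐ zer) ⇒ ∃≤ x (var 0 ⊕ one ≐ var 1))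
  L1  : AxV⁰2 (mem y 0 ⇒ (y <' len 0))
  L2  : AxV⁰2 ((y ⊕ one ≐ len 0) ⇒ mem y 0)
  SE  : AxV⁰2 (((len 0 ≐ len 1) ∧'
                 ∀<' (len 0) (mem (var 0) 0 ⇔ mem (var 0) 1)) ⇒ (0 ≐₂ 1))
  -- Σ^B_0 comprehension:  ∃X≤y ∀z<y (X(z) ↔ φ(z)),
  -- φ Σ^B_0; inside φ: var 0 = z, var (suc i) = outer var i (outer var 0 = y);
  -- φ's set variables are shifted so that X does not occur in it.
  COMP : ∀ {φ} → ΣB₀ φ →
         AxV⁰2 (∃₂ ((len 0 ≼ var 0) ∧'
                    ∀<' (var 0) (mem (var 0) 0 ⇔ ↑₂ φ)))
  PAR  : AxV⁰2 (∃₂ (¬' (mem zer 0) ∧'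
                    ∀<' (var 0) (mem (var 0 ⊕ one) 0 ⇔ (mem (var 0) 0 xor mem (var 0) 1))))

infix 0 _⊢_

data _⊢_ (Γ : List Fm) : Fm → Set where
  hyp  : ∀ {φ} → φ ∈ Γ → Γ ⊢ φ
  ax   : ∀ {φ} → AxV⁰2 φ → Γ ⊢ φ
  ⇒I   : ∀ {φ ψ} → (φ ∷ Γ) ⊢ ψ → Γ ⊢ φ ⇒ ψ
  ⇒E   : ∀ {φ ψ} → Γ ⊢ φ ⇒ ψ → Γ ⊢ φ → Γ ⊢ ψ
  ∧I   : ∀ {φ ψ} → Γ ⊢ φ → Γ ⊢ ψ → Γ ⊢ φ ∧' ψ
  ∧E₁  : ∀ {φ ψ} → Γ ⊢ φ ∧' ψ → Γ ⊢ φ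
  ∧E₂  : ∀ {φ ψ} → Γ ⊢ φ ∧' ψ → Γ ⊢ ψ
  ∨I₁  : ∀ {φ ψ} → Γ ⊢ φ → Γ ⊢ φ ∨' ψ
  ∨I₂  : ∀ {φ ψ} → Γ ⊢ ψ → Γ ⊢ φ ∨' ψ
  ∨E   : ∀ {φ ψ χ} → Γ ⊢ φ ∨' ψ → (φ ∷ Γ) ⊢ χ → (ψ ∷ Γ) ⊢ χ → Γ ⊢ χ
  raa  : ∀ {φ} → (¬' φ ∷ Γ) ⊢ ⊥' → Γ ⊢ φ
  ∀₁I  : ∀ {φ} → map ↑₁ Γ ⊢ φ → Γ ⊢ ∀₁ φ
  ∀₁E  : ∀ {φ} → Γ ⊢ ∀₁ φ → (t : Tm) → Γ ⊢ sub₁ t φ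
  ∃₁I  : ∀ {φ} (t : Tm) → Γ ⊢ sub₁ t φ → Γ ⊢ ∃₁ φ
  ∃₁E  : ∀ {φ ψ} → Γ ⊢ ∃₁ φ → (φ ∷ map ↑₁ Γ) ⊢ ↑₁ ψ → Γ ⊢ ψ
  ∀₂I  : ∀ {φ} → map ↑₂ Γ ⊢ φ → Γ ⊢ ∀₂ φ
  ∀₂E  : ∀ {φ} → Γ ⊢ ∀₂ φ → (j : ℕ) → Γ ⊢ sub₂ j φ
  ∃₂I  : ∀ {φ} (j : ℕ) → Γ ⊢ sub₂ j φ → Γ ⊢ ∃₂ φ
  ∃₂E  : ∀ {φ ψ} → Γ ⊢ ∃₂ φ → (φ ∷ map ↑₂ Γ) ⊢ ↑₂ ψ → Γ ⊢ ψ
  refl₁  : ∀ t → Γ ⊢ t ≐ t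
  subst₁ : ∀ {s t} φ → Γ ⊢ s ≐ t → Γ ⊢ sub₁ s φ → Γ ⊢ sub₁ t φ
  refl₂  : ∀ i → Γ ⊢ i ≐₂ i
  subst₂ : ∀ {i j} φ → Γ ⊢ i ≐₂ j → Γ ⊢ sub₂ i φ → Γ ⊢ sub₂ j φ

V⁰2⊢ : Fm → Set
V⁰2⊢ φ = [] ⊢ φ

-- Cook–Nguyen pairing function  ⟨x,y⟩ = (x+y)(x+y+1) + 2y
pair : Tm → Tm → Tm
pair a b = ((a ⊕ b) ⊗ ((a ⊕ b) ⊕ one)) ⊕ (two ⊗ b)

-- point (a,b) coded as ⟨a,b⟩; the edge between (a,b),(a+1,b) is coded
-- ⟨⟨a,b⟩,⟨a+1,b⟩⟩, the edge between (a,b),(a,b+1) as ⟨⟨a,b⟩,⟨a,b+1⟩⟩.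
hEdge vEdge : Tm → Tm → Tm
hEdge a b = pair (pair a b) (pair (a ⊕ one) b)
vEdge a b = pair (pair a b) (pair a (b ⊕ one))

right up left down : ℕ → Tm → Tm → Fm
right E a b = mem (hEdge a b) E
up    E a b = mem (vEdge a b) E
left  E a b = ∃≤ a ((var 0 ⊕ one ≐ ↑ a) ∧' mem (hEdge (var 0) (↑ b)) E)
down  E a b = ∃≤ b ((var 0 ⊕ one ≐ ↑ b) ∧' mem (vEdge (↑ a) (var 0)) E)

deg0 deg1 deg2 degPos : ℕ → Tm → Tm → Fm
deg0 E a b = ¬' (right E a b) ∧' ¬' (left E a b) ∧' ¬' (up E a b) ∧' ¬' (down E a b)
deg1 E a b =
     (right E a b ∧' ¬' (left E a b) ∧' ¬' (up E a b) ∧' ¬' (down E a b))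
  ∨' (¬' (right E a b) ∧' left E a b ∧' ¬' (up E a b) ∧' ¬' (down E a b))
  ∨' (¬' (right E a b) ∧' ¬' (left E a b) ∧' up E a b ∧' ¬' (down E a b))
  ∨' (¬' (right E a b) ∧' ¬' (left E a b) ∧' ¬' (up E a b) ∧' down E a b)
deg2 E a b =
     (right E a b ∧' left E a b ∧' ¬' (up E a b) ∧' ¬' (down E a b))
  ∨' (right E a b ∧' ¬' (left E a b) ∧' up E a b ∧' ¬' (down E a b))
  ∨' (right E a b ∧' ¬' (left E a b) ∧' ¬' (up E a b) ∧' down E a b)
  ∨' (¬' (right E a b) ∧' left E a b ∧' up E a b ∧' ¬' (down E a b))
  ∨' (¬' (right E a b) ∧' left E a b ∧' ¬' (up E a b) ∧' down E a b)
  ∨' (¬' (right E a b) ∧' ¬' (left E a b) ∧' up E a b ∧' down E a b)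
degPos E a b = right E a b ∨' left E a b ∨' up E a b ∨' down E a b

-- quantification over grid points (a,b), 0 ≤ a,b ≤ n.  The body receives
-- the shift to apply to outer terms, and the terms for a and b.
forallGrid existsGrid : Tm → ((Tm → Tm) → Tm → Tm → Fm) → Fm
forallGrid n P = ∀≤ n (∀≤ (↑ n) (P (λ t → ↑ (↑ t)) (var 1) (var 0)))
existsGrid n P = ∃≤ n (∃≤ (↑ n) (P (λ t → ↑ (↑ t)) (var 1) (var 0)))

isGridEdge : Tm → Tm → Fm
isGridEdge n e = existsGrid n (λ s a b →
     ((a ⊕ one ≼ s n) ∧' (s e ≐ hEdge a b))
  ∨' ((b ⊕ one ≼ s n) ∧' (s e ≐ vEdge a b)))

edgeSet : Tm → ℕ → Fm
edgeSet n E = ∀≤ (len E) (mem (var 0) E ⇒ isGridEdge (↑ n) (var 0))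

curve : Tm → ℕ → Fm
curve n E = ∃≤ (len E) (mem (var 0) E) ∧'
            forallGrid n (λ s a b → deg0 E a b ∨' deg2 E a b)

diffSides : Tm → ℕ → Tm → Tm → Tm → Tm → Fm
diffSides n E a1 b1 a2 b2 =
  (a1 ≼ n) ∧' (b1 ≼ n) ∧' (a2 ≼ n) ∧' (b2 ≼ n) ∧'
  (a1 ≐ a2) ∧'
  (((b2 ≐ b1 ⊕ two) ∧' deg2 E a1 (b1 ⊕ one)) ∨'
   ((b1 ≐ b2 ⊕ two) ∧' deg2 E a1 (b2 ⊕ one))) ∧'
  deg0 E a1 b1 ∧' deg0 E a2 b2

connects : Tm → ℕ → Tm → Tm → Tm → Tm → Fm
connects n E a1 b1 a2 b2 =
  deg1 E a1 b1 ∧' deg1 E a2 b2 ∧'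
  forallGrid n (λ s a b →
    (¬' ((a ≐ s a1) ∧' (b ≐ s b1)) ∧' ¬' ((a ≐ s a2) ∧' (b ≐ s b2)))
      ⇒ (deg0 E a b ∨' deg2 E a b))

intersect : Tm → ℕ → ℕ → Fm
intersect n E₁ E₂ = existsGrid n (λ s a b → degPos E₁ a b ∧' degPos E₂ a b)

jordanOpen : Fm
jordanOpen =
  (edgeSet n B ∧' curve n B ∧'
   diffSides n B a1 b1 a2 b2 ∧'
   edgeSet n R ∧' connects n R a1 b1 a2 b2)
  ⇒ intersect n B R
  where
    n a1 b1 a2 b2 : Tm
    n = var 4 ; a1 = var 3 ; b1 = var 2 ; a2 = var 1 ; b2 = var 0
    B R : ℕ
    B = 1 ; R = 0

jordanGrid : Fm
jordanGrid = ∀₂ (∀₂ (∀₁ (∀₁ (∀₁ (∀₁ (∀₁ jordanOpen))))))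

-- Suppose B and R do not meet. Colour a grid point by the parity of the horizontal edges of B
-- strictly below it in the strip to its right. As degrees of B are even, the colour changes
-- along an edge only if the edge touches B, so it is constant along the edges of R, whereas
-- it differs at p₁ and p₂. Hence exactly one endpoint q of R has colour 0. Summing the degrees
-- of R over the points of colour 0 in one column of the grid, vertical edges cancel; so the
-- parity of the horizontal colour-0 edges of R between columns a and a + 1 changes exactly
-- at the column of q. It is 0 to the left of the grid, hence 1 to the right of it, where R has
-- no edges. Only two parity vectors are needed, each for the concatenation of all columns.
--
-- Since some variable is fresh for Γ, ∀₁ φ is derivable from Γ once all its instances are;
-- this rule replaces de Bruijn shifts by terms of the metalanguage. Terms modulo provable
-- equality form a commutative semiring, so the ring solver yields derivations.

module Submission where

open import Defs

open import Algebra.Bundles using (CommutativeSemiring)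
import Algebra.Solver.Ring.NaturalCoefficients.Default as NatSolver
open import Algebra.Structures.Biased using (isCommutativeSemiringˡ)
open import Data.Bool using (Bool; true; false; _∧_; _∨_; T)
open import Data.List using (List; []; _∷_; map; length)
open import Data.List.Membership.Propositional using (_∈_)
open import Data.List.Relation.Binary.Subset.Propositional using (_⊆_)
open import Data.List.Relation.Binary.Subset.Propositional.Properties using (map⁺; ∷⁺ʳ)
open import Data.List.Relation.Unary.Any using (here; there)
open import Data.Nat using (ℕ; zero; suc; pred; _+_; _⊔_; _<_; s≤s)
open import Data.Nat.Properties using (≤-trans; ≤-refl; n≤1+n; m≤m⊔n; m≤n⊔m; +-suc)
open import Data.Product using (_,_)
open import Function using (_∘_; id)
open import Level using (0ℓ)
open import Relation.Binary.PropositionalEquality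
  using (_≡_; refl; sym; trans; cong; cong₂; subst) renaming (subst₂ to ≡-subst₂)
open import Relation.Binary.Structures using (IsEquivalence)

private variable
  Γ Δ : List Fm
  φ ψ χ θ : Fm
  s t u v : Tm
  a b c d n : Tm
  σ τ : ℕ → Tm
  ρ π : ℕ → ℕ

-- Substitution calculus

-- A strict upper bound on the free indices, one more than the largest of them; hence `pred` under a
-- binder.
fvTm : Tm → ℕ
fvTm (var i) = suc i
fvTm zer = 0
fvTm one = 0
fvTm (s ⊕ t) = fvTm s ⊔ fvTm t
fvTm (s ⊗ t) = fvTm s ⊔ fvTm t
fvTm (len i) = 0

fv : Fm → ℕ
fv (s ≐ t) = fvTm s ⊔ fvTm t
fv (s ≼ t) = fvTm s ⊔ fvTm t
fv (mem t i) = fvTm t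
fv (i ≐₂ j) = 0
fv ⊥' = 0
fv (φ ⇒ ψ) = fv φ ⊔ fv ψ
fv (φ ∧' ψ) = fv φ ⊔ fv ψ
fv (φ ∨' ψ) = fv φ ⊔ fv ψ
fv (∀₁ φ) = pred (fv φ)
fv (∃₁ φ) = pred (fv φ)
fv (∀₂ φ) = fv φ
fv (∃₂ φ) = fv φ

fvTm₂ : Tm → ℕ
fvTm₂ (var i) = 0
fvTm₂ zer = 0
fvTm₂ one = 0
fvTm₂ (s ⊕ t) = fvTm₂ s ⊔ fvTm₂ t
fvTm₂ (s ⊗ t) = fvTm₂ s ⊔ fvTm₂ t
fvTm₂ (len i) = suc i

fv₂ : Fm → ℕ
fv₂ (s ≐ t) = fvTm₂ s ⊔ fvTm₂ t
fv₂ (s ≼ t) = fvTm₂ s ⊔ fvTm₂ t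
fv₂ (mem t i) = fvTm₂ t ⊔ suc i
fv₂ (i ≐₂ j) = suc i ⊔ suc j
fv₂ ⊥' = 0
fv₂ (φ ⇒ ψ) = fv₂ φ ⊔ fv₂ ψ
fv₂ (φ ∧' ψ) = fv₂ φ ⊔ fv₂ ψ
fv₂ (φ ∨' ψ) = fv₂ φ ⊔ fv₂ ψ
fv₂ (∀₁ φ) = fv₂ φ
fv₂ (∃₁ φ) = fv₂ φ
fv₂ (∀₂ φ) = pred (fv₂ φ)
fv₂ (∃₂ φ) = pred (fv₂ φ)

Agree : {A : Set} → ℕ → (f g : ℕ → A) → Set
Agree n f g = ∀ i → i < n → f i ≡ g i

agreeˡ : ∀ {A : Set} m n {f g : ℕ → A} → Agree (m ⊔ n) f g → Agree m f g
agreeˡ m n h i p = h i (≤-trans p (m≤m⊔n m n))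

agreeʳ : ∀ {A : Set} m n {f g : ℕ → A} → Agree (m ⊔ n) f g → Agree n f g
agreeʳ m n h i p = h i (≤-trans p (m≤n⊔m m n))

<pred : ∀ {i n} → suc i < n → i < pred n
<pred (s≤s p) = p

lift₁-agree : ∀ n → Agree (pred n) σ τ → Agree n (lift₁ σ) (lift₁ τ)
lift₁-agree n h zero p = refl
lift₁-agree n h (suc i) p = cong ↑ (h i (<pred p))

liftR-agree : ∀ n → Agree (pred n) ρ π → Agree n (liftR ρ) (liftR π)
liftR-agree n h zero p = refl
liftR-agree n h (suc i) p = cong suc (h i (<pred p))

subTm-agree : ∀ t → Agree (fvTm t) σ τ → subTm σ t ≡ subTm τ t
subTm-agree (var i) h = h i ≤-refl
subTm-agree zer h = refl
subTm-agree one h = refl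
subTm-agree (s ⊕ t) h = cong₂ _⊕_ (subTm-agree s (agreeˡ (fvTm s) (fvTm t) h)) (subTm-agree t (agreeʳ (fvTm s) (fvTm t) h))
subTm-agree (s ⊗ t) h = cong₂ _⊗_ (subTm-agree s (agreeˡ (fvTm s) (fvTm t) h)) (subTm-agree t (agreeʳ (fvTm s) (fvTm t) h))
subTm-agree (len i) h = refl

subFm-agree : ∀ φ → Agree (fv φ) σ τ → subFm σ φ ≡ subFm τ φ
subFm-agree (s ≐ t) h = cong₂ _≐_ (subTm-agree s (agreeˡ (fvTm s) (fvTm t) h)) (subTm-agree t (agreeʳ (fvTm s) (fvTm t) h))
subFm-agree (s ≼ t) h = cong₂ _≼_ (subTm-agree s (agreeˡ (fvTm s) (fvTm t) h)) (subTm-agree t (agreeʳ (fvTm s) (fvTm t) h))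
subFm-agree (mem t i) h = cong (λ z → mem z i) (subTm-agree t h)
subFm-agree (i ≐₂ j) h = refl
subFm-agree ⊥' h = refl
subFm-agree (φ ⇒ ψ) h = cong₂ _⇒_ (subFm-agree φ (agreeˡ (fv φ) (fv ψ) h)) (subFm-agree ψ (agreeʳ (fv φ) (fv ψ) h))
subFm-agree (φ ∧' ψ) h = cong₂ _∧'_ (subFm-agree φ (agreeˡ (fv φ) (fv ψ) h)) (subFm-agree ψ (agreeʳ (fv φ) (fv ψ) h))
subFm-agree (φ ∨' ψ) h = cong₂ _∨'_ (subFm-agree φ (agreeˡ (fv φ) (fv ψ) h)) (subFm-agree ψ (agreeʳ (fv φ) (fv ψ) h))
subFm-agree (∀₁ φ) h = cong ∀₁ (subFm-agree φ (lift₁-agree (fv φ) h))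
subFm-agree (∃₁ φ) h = cong ∃₁ (subFm-agree φ (lift₁-agree (fv φ) h))
subFm-agree (∀₂ φ) h = cong ∀₂ (subFm-agree φ (λ i p → cong (renTm₂ suc) (h i p)))
subFm-agree (∃₂ φ) h = cong ∃₂ (subFm-agree φ (λ i p → cong (renTm₂ suc) (h i p)))

subFm-cong : (∀ i → σ i ≡ τ i) → ∀ φ → subFm σ φ ≡ subFm τ φ
subFm-cong h φ = subFm-agree φ (λ i _ → h i)

renTm₂-agree : ∀ t → Agree (fvTm₂ t) ρ π → renTm₂ ρ t ≡ renTm₂ π t
renTm₂-agree (var i) h = refl
renTm₂-agree zer h = refl
renTm₂-agree one h = refl
renTm₂-agree (s ⊕ t) h = cong₂ _⊕_ (renTm₂-agree s (agreeˡ (fvTm₂ s) (fvTm₂ t) h)) (renTm₂-agree t (agreeʳ (fvTm₂ s) (fvTm₂ t) h))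
renTm₂-agree (s ⊗ t) h = cong₂ _⊗_ (renTm₂-agree s (agreeˡ (fvTm₂ s) (fvTm₂ t) h)) (renTm₂-agree t (agreeʳ (fvTm₂ s) (fvTm₂ t) h))
renTm₂-agree (len i) h = cong len (h i ≤-refl)

renFm₂-agree : ∀ φ → Agree (fv₂ φ) ρ π → renFm₂ ρ φ ≡ renFm₂ π φ
renFm₂-agree (s ≐ t) h = cong₂ _≐_ (renTm₂-agree s (agreeˡ (fvTm₂ s) (fvTm₂ t) h)) (renTm₂-agree t (agreeʳ (fvTm₂ s) (fvTm₂ t) h))
renFm₂-agree (s ≼ t) h = cong₂ _≼_ (renTm₂-agree s (agreeˡ (fvTm₂ s) (fvTm₂ t) h)) (renTm₂-agree t (agreeʳ (fvTm₂ s) (fvTm₂ t) h))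
renFm₂-agree (mem t i) h = cong₂ mem (renTm₂-agree t (agreeˡ (fvTm₂ t) (suc i) h)) (agreeʳ (fvTm₂ t) (suc i) h i ≤-refl)
renFm₂-agree (i ≐₂ j) h = cong₂ _≐₂_ (agreeˡ (suc i) (suc j) h i ≤-refl) (agreeʳ (suc i) (suc j) h j ≤-refl)
renFm₂-agree ⊥' h = refl
renFm₂-agree (φ ⇒ ψ) h = cong₂ _⇒_ (renFm₂-agree φ (agreeˡ (fv₂ φ) (fv₂ ψ) h)) (renFm₂-agree ψ (agreeʳ (fv₂ φ) (fv₂ ψ) h))
renFm₂-agree (φ ∧' ψ) h = cong₂ _∧'_ (renFm₂-agree φ (agreeˡ (fv₂ φ) (fv₂ ψ) h)) (renFm₂-agree ψ (agreeʳ (fv₂ φ) (fv₂ ψ) h))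
renFm₂-agree (φ ∨' ψ) h = cong₂ _∨'_ (renFm₂-agree φ (agreeˡ (fv₂ φ) (fv₂ ψ) h)) (renFm₂-agree ψ (agreeʳ (fv₂ φ) (fv₂ ψ) h))
renFm₂-agree (∀₁ φ) h = cong ∀₁ (renFm₂-agree φ h)
renFm₂-agree (∃₁ φ) h = cong ∃₁ (renFm₂-agree φ h)
renFm₂-agree (∀₂ φ) h = cong ∀₂ (renFm₂-agree φ (liftR-agree (fv₂ φ) h))
renFm₂-agree (∃₂ φ) h = cong ∃₂ (renFm₂-agree φ (liftR-agree (fv₂ φ) h))

renFm₂-cong : (∀ i → ρ i ≡ π i) → ∀ φ → renFm₂ ρ φ ≡ renFm₂ π φ
renFm₂-cong h φ = renFm₂-agree φ (λ i _ → h i)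

subTm-id : ∀ t → subTm var t ≡ t
subTm-id (var i) = refl
subTm-id zer = refl
subTm-id one = refl
subTm-id (s ⊕ t) = cong₂ _⊕_ (subTm-id s) (subTm-id t)
subTm-id (s ⊗ t) = cong₂ _⊗_ (subTm-id s) (subTm-id t)
subTm-id (len i) = refl

lift₁-var : ∀ i → lift₁ var i ≡ var i
lift₁-var zero = refl
lift₁-var (suc i) = refl

subFm-id : ∀ φ → subFm var φ ≡ φ
subFm-id (s ≐ t) = cong₂ _≐_ (subTm-id s) (subTm-id t)
subFm-id (s ≼ t) = cong₂ _≼_ (subTm-id s) (subTm-id t)
subFm-id (mem t i) = cong (λ z → mem z i) (subTm-id t)
subFm-id (i ≐₂ j) = refl
subFm-id ⊥' = refl
subFm-id (φ ⇒ ψ) = cong₂ _⇒_ (subFm-id φ) (subFm-id ψ)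
subFm-id (φ ∧' ψ) = cong₂ _∧'_ (subFm-id φ) (subFm-id ψ)
subFm-id (φ ∨' ψ) = cong₂ _∨'_ (subFm-id φ) (subFm-id ψ)
subFm-id (∀₁ φ) = cong ∀₁ (trans (subFm-cong lift₁-var φ) (subFm-id φ))
subFm-id (∃₁ φ) = cong ∃₁ (trans (subFm-cong lift₁-var φ) (subFm-id φ))
subFm-id (∀₂ φ) = cong ∀₂ (subFm-id φ)
subFm-id (∃₂ φ) = cong ∃₂ (subFm-id φ)

renTm₂-id : ∀ t → renTm₂ id t ≡ t
renTm₂-id (var i) = refl
renTm₂-id zer = refl
renTm₂-id one = refl
renTm₂-id (s ⊕ t) = cong₂ _⊕_ (renTm₂-id s) (renTm₂-id t)
renTm₂-id (s ⊗ t) = cong₂ _⊗_ (renTm₂-id s) (renTm₂-id t)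
renTm₂-id (len i) = refl

liftR-id : ∀ i → liftR id i ≡ i
liftR-id zero = refl
liftR-id (suc i) = refl

renFm₂-id : ∀ φ → renFm₂ id φ ≡ φ
renFm₂-id (s ≐ t) = cong₂ _≐_ (renTm₂-id s) (renTm₂-id t)
renFm₂-id (s ≼ t) = cong₂ _≼_ (renTm₂-id s) (renTm₂-id t)
renFm₂-id (mem t i) = cong (λ z → mem z i) (renTm₂-id t)
renFm₂-id (i ≐₂ j) = refl
renFm₂-id ⊥' = refl
renFm₂-id (φ ⇒ ψ) = cong₂ _⇒_ (renFm₂-id φ) (renFm₂-id ψ)
renFm₂-id (φ ∧' ψ) = cong₂ _∧'_ (renFm₂-id φ) (renFm₂-id ψ)
renFm₂-id (φ ∨' ψ) = cong₂ _∨'_ (renFm₂-id φ) (renFm₂-id ψ)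
renFm₂-id (∀₁ φ) = cong ∀₁ (renFm₂-id φ)
renFm₂-id (∃₁ φ) = cong ∃₁ (renFm₂-id φ)
renFm₂-id (∀₂ φ) = cong ∀₂ (trans (renFm₂-cong liftR-id φ) (renFm₂-id φ))
renFm₂-id (∃₂ φ) = cong ∃₂ (trans (renFm₂-cong liftR-id φ) (renFm₂-id φ))

subTm-∘ : ∀ σ τ t → subTm σ (subTm τ t) ≡ subTm (λ i → subTm σ (τ i)) t
subTm-∘ σ τ (var i) = refl
subTm-∘ σ τ zer = refl
subTm-∘ σ τ one = refl
subTm-∘ σ τ (s ⊕ t) = cong₂ _⊕_ (subTm-∘ σ τ s) (subTm-∘ σ τ t)
subTm-∘ σ τ (s ⊗ t) = cong₂ _⊗_ (subTm-∘ σ τ s) (subTm-∘ σ τ t)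
subTm-∘ σ τ (len i) = refl

-- `∀≤ t` and `∃≤ t` store `↑ t` under their binder. This equation keeps them bounded quantifiers
-- after a substitution.
subTm-lift-↑ : ∀ σ t → subTm (lift₁ σ) (↑ t) ≡ ↑ (subTm σ t)
subTm-lift-↑ σ t = trans (subTm-∘ _ _ t) (sym (subTm-∘ _ _ t))

renTm₂-∘ : ∀ ρ π t → renTm₂ ρ (renTm₂ π t) ≡ renTm₂ (ρ ∘ π) t
renTm₂-∘ ρ π (var i) = refl
renTm₂-∘ ρ π zer = refl
renTm₂-∘ ρ π one = refl
renTm₂-∘ ρ π (s ⊕ t) = cong₂ _⊕_ (renTm₂-∘ ρ π s) (renTm₂-∘ ρ π t)
renTm₂-∘ ρ π (s ⊗ t) = cong₂ _⊗_ (renTm₂-∘ ρ π s) (renTm₂-∘ ρ π t)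
renTm₂-∘ ρ π (len i) = refl

renTm₂-subTm : ∀ ρ σ t → renTm₂ ρ (subTm σ t) ≡ subTm (λ i → renTm₂ ρ (σ i)) (renTm₂ ρ t)
renTm₂-subTm ρ σ (var i) = refl
renTm₂-subTm ρ σ zer = refl
renTm₂-subTm ρ σ one = refl
renTm₂-subTm ρ σ (s ⊕ t) = cong₂ _⊕_ (renTm₂-subTm ρ σ s) (renTm₂-subTm ρ σ t)
renTm₂-subTm ρ σ (s ⊗ t) = cong₂ _⊗_ (renTm₂-subTm ρ σ s) (renTm₂-subTm ρ σ t)
renTm₂-subTm ρ σ (len i) = refl

lift₁-∘ : ∀ σ τ i → subTm (lift₁ σ) (lift₁ τ i) ≡ lift₁ (λ j → subTm σ (τ j)) i
lift₁-∘ σ τ zero = refl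
lift₁-∘ σ τ (suc i) = subTm-lift-↑ σ (τ i)

subFm-∘ : ∀ σ τ φ → subFm σ (subFm τ φ) ≡ subFm (λ i → subTm σ (τ i)) φ
subFm-∘ σ τ (s ≐ t) = cong₂ _≐_ (subTm-∘ σ τ s) (subTm-∘ σ τ t)
subFm-∘ σ τ (s ≼ t) = cong₂ _≼_ (subTm-∘ σ τ s) (subTm-∘ σ τ t)
subFm-∘ σ τ (mem t i) = cong (λ z → mem z i) (subTm-∘ σ τ t)
subFm-∘ σ τ (i ≐₂ j) = refl
subFm-∘ σ τ ⊥' = refl
subFm-∘ σ τ (φ ⇒ ψ) = cong₂ _⇒_ (subFm-∘ σ τ φ) (subFm-∘ σ τ ψ)
subFm-∘ σ τ (φ ∧' ψ) = cong₂ _∧'_ (subFm-∘ σ τ φ) (subFm-∘ σ τ ψ)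
subFm-∘ σ τ (φ ∨' ψ) = cong₂ _∨'_ (subFm-∘ σ τ φ) (subFm-∘ σ τ ψ)
subFm-∘ σ τ (∀₁ φ) = cong ∀₁ (trans (subFm-∘ _ _ φ) (subFm-cong (lift₁-∘ σ τ) φ))
subFm-∘ σ τ (∃₁ φ) = cong ∃₁ (trans (subFm-∘ _ _ φ) (subFm-cong (lift₁-∘ σ τ) φ))
subFm-∘ σ τ (∀₂ φ) = cong ∀₂ (trans (subFm-∘ _ _ φ) (subFm-cong (λ i → sym (renTm₂-subTm suc σ (τ i))) φ))
subFm-∘ σ τ (∃₂ φ) = cong ∃₂ (trans (subFm-∘ _ _ φ) (subFm-cong (λ i → sym (renTm₂-subTm suc σ (τ i))) φ))

liftR-∘ : ∀ ρ π i → liftR ρ (liftR π i) ≡ liftR (ρ ∘ π) i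
liftR-∘ ρ π zero = refl
liftR-∘ ρ π (suc i) = refl

renFm₂-∘ : ∀ ρ π φ → renFm₂ ρ (renFm₂ π φ) ≡ renFm₂ (ρ ∘ π) φ
renFm₂-∘ ρ π (s ≐ t) = cong₂ _≐_ (renTm₂-∘ ρ π s) (renTm₂-∘ ρ π t)
renFm₂-∘ ρ π (s ≼ t) = cong₂ _≼_ (renTm₂-∘ ρ π s) (renTm₂-∘ ρ π t)
renFm₂-∘ ρ π (mem t i) = cong (λ z → mem z (ρ (π i))) (renTm₂-∘ ρ π t)
renFm₂-∘ ρ π (i ≐₂ j) = refl
renFm₂-∘ ρ π ⊥' = refl
renFm₂-∘ ρ π (φ ⇒ ψ) = cong₂ _⇒_ (renFm₂-∘ ρ π φ) (renFm₂-∘ ρ π ψ)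
renFm₂-∘ ρ π (φ ∧' ψ) = cong₂ _∧'_ (renFm₂-∘ ρ π φ) (renFm₂-∘ ρ π ψ)
renFm₂-∘ ρ π (φ ∨' ψ) = cong₂ _∨'_ (renFm₂-∘ ρ π φ) (renFm₂-∘ ρ π ψ)
renFm₂-∘ ρ π (∀₁ φ) = cong ∀₁ (renFm₂-∘ ρ π φ)
renFm₂-∘ ρ π (∃₁ φ) = cong ∃₁ (renFm₂-∘ ρ π φ)
renFm₂-∘ ρ π (∀₂ φ) = cong ∀₂ (trans (renFm₂-∘ _ _ φ) (renFm₂-cong (liftR-∘ ρ π) φ))
renFm₂-∘ ρ π (∃₂ φ) = cong ∃₂ (trans (renFm₂-∘ _ _ φ) (renFm₂-cong (liftR-∘ ρ π) φ))

renTm₂-lift₁ : ∀ ρ σ i → renTm₂ ρ (lift₁ σ i) ≡ lift₁ (λ j → renTm₂ ρ (σ j)) i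
renTm₂-lift₁ ρ σ zero = refl
renTm₂-lift₁ ρ σ (suc i) = renTm₂-subTm ρ _ (σ i)

renTm₂-liftR-suc : ∀ ρ t → renTm₂ (liftR ρ) (renTm₂ suc t) ≡ renTm₂ suc (renTm₂ ρ t)
renTm₂-liftR-suc ρ t = trans (renTm₂-∘ _ _ t) (sym (renTm₂-∘ _ _ t))

renFm₂-subFm : ∀ ρ σ φ → renFm₂ ρ (subFm σ φ) ≡ subFm (λ i → renTm₂ ρ (σ i)) (renFm₂ ρ φ)
renFm₂-subFm ρ σ (s ≐ t) = cong₂ _≐_ (renTm₂-subTm ρ σ s) (renTm₂-subTm ρ σ t)
renFm₂-subFm ρ σ (s ≼ t) = cong₂ _≼_ (renTm₂-subTm ρ σ s) (renTm₂-subTm ρ σ t)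
renFm₂-subFm ρ σ (mem t i) = cong (λ z → mem z (ρ i)) (renTm₂-subTm ρ σ t)
renFm₂-subFm ρ σ (i ≐₂ j) = refl
renFm₂-subFm ρ σ ⊥' = refl
renFm₂-subFm ρ σ (φ ⇒ ψ) = cong₂ _⇒_ (renFm₂-subFm ρ σ φ) (renFm₂-subFm ρ σ ψ)
renFm₂-subFm ρ σ (φ ∧' ψ) = cong₂ _∧'_ (renFm₂-subFm ρ σ φ) (renFm₂-subFm ρ σ ψ)
renFm₂-subFm ρ σ (φ ∨' ψ) = cong₂ _∨'_ (renFm₂-subFm ρ σ φ) (renFm₂-subFm ρ σ ψ)
renFm₂-subFm ρ σ (∀₁ φ) = cong ∀₁ (trans (renFm₂-subFm ρ _ φ) (subFm-cong (renTm₂-lift₁ ρ σ) _))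
renFm₂-subFm ρ σ (∃₁ φ) = cong ∃₁ (trans (renFm₂-subFm ρ _ φ) (subFm-cong (renTm₂-lift₁ ρ σ) _))
renFm₂-subFm ρ σ (∀₂ φ) = cong ∀₂ (trans (renFm₂-subFm _ _ φ) (subFm-cong (λ i → renTm₂-liftR-suc ρ (σ i)) _))
renFm₂-subFm ρ σ (∃₂ φ) = cong ∃₂ (trans (renFm₂-subFm _ _ φ) (subFm-cong (λ i → renTm₂-liftR-suc ρ (σ i)) _))

inst-↑ : ∀ u t → subTm (inst₁ u) (↑ t) ≡ t
inst-↑ u t = trans (subTm-∘ _ _ t) (subTm-id t)

sub₁-↑₁ : ∀ u φ → sub₁ u (↑₁ φ) ≡ φ
sub₁-↑₁ u φ = trans (subFm-∘ _ _ φ) (subFm-id φ)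

inst₂-suc : ∀ j t → renTm₂ (inst₂ j) (renTm₂ suc t) ≡ t
inst₂-suc j t = trans (renTm₂-∘ _ _ t) (renTm₂-id t)

sub₂-↑₂ : ∀ j φ → sub₂ j (↑₂ φ) ≡ φ
sub₂-↑₂ j φ = trans (renFm₂-∘ _ _ φ) (renFm₂-id φ)

ΣB₀-sub : ∀ σ → ΣB₀ φ → ΣB₀ (subFm σ φ)
ΣB₀-sub σ (eq s t) = eq _ _
ΣB₀-sub σ (le s t) = le _ _
ΣB₀-sub σ (mm t i) = mm _ _
ΣB₀-sub σ (eq₂ i j) = eq₂ _ _
ΣB₀-sub σ bot = bot
ΣB₀-sub σ (imp a b) = imp (ΣB₀-sub σ a) (ΣB₀-sub σ b)
ΣB₀-sub σ (conj a b) = conj (ΣB₀-sub σ a) (ΣB₀-sub σ b)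
ΣB₀-sub σ (disj a b) = disj (ΣB₀-sub σ a) (ΣB₀-sub σ b)
ΣB₀-sub σ (ball t {φ} a) = subst (λ z → ΣB₀ (∀₁ ((var 0 ≼ z) ⇒ subFm (lift₁ σ) φ))) (sym (subTm-lift-↑ σ t)) (ball (subTm σ t) (ΣB₀-sub _ a))
ΣB₀-sub σ (bex t {φ} a) = subst (λ z → ΣB₀ (∃₁ ((var 0 ≼ z) ∧' subFm (lift₁ σ) φ))) (sym (subTm-lift-↑ σ t)) (bex (subTm σ t) (ΣB₀-sub _ a))

-- Weakening and shift-free quantifier rules

weaken : Γ ⊆ Δ → Γ ⊢ φ → Δ ⊢ φ
weaken h (hyp p) = hyp (h p)
weaken h (ax a) = ax a
weaken h (⇒I d) = ⇒I (weaken (∷⁺ʳ _ h) d)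
weaken h (⇒E d e) = ⇒E (weaken h d) (weaken h e)
weaken h (∧I d e) = ∧I (weaken h d) (weaken h e)
weaken h (∧E₁ d) = ∧E₁ (weaken h d)
weaken h (∧E₂ d) = ∧E₂ (weaken h d)
weaken h (∨I₁ d) = ∨I₁ (weaken h d)
weaken h (∨I₂ d) = ∨I₂ (weaken h d)
weaken h (∨E d e f) = ∨E (weaken h d) (weaken (∷⁺ʳ _ h) e) (weaken (∷⁺ʳ _ h) f)
weaken h (raa d) = raa (weaken (∷⁺ʳ _ h) d)
weaken h (∀₁I d) = ∀₁I (weaken (map⁺ ↑₁ h) d)
weaken h (∀₁E d t) = ∀₁E (weaken h d) t
weaken h (∃₁I t d) = ∃₁I t (weaken h d)
weaken h (∃₁E d e) = ∃₁E (weaken h d) (weaken (∷⁺ʳ _ (map⁺ ↑₁ h)) e)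
weaken h (∀₂I d) = ∀₂I (weaken (map⁺ ↑₂ h) d)
weaken h (∀₂E d j) = ∀₂E (weaken h d) j
weaken h (∃₂I j d) = ∃₂I j (weaken h d)
weaken h (∃₂E d e) = ∃₂E (weaken h d) (weaken (∷⁺ʳ _ (map⁺ ↑₂ h)) e)
weaken h (refl₁ t) = refl₁ t
weaken h (subst₁ φ d e) = subst₁ φ (weaken h d) (weaken h e)
weaken h (refl₂ i) = refl₂ i
weaken h (subst₂ φ d e) = subst₂ φ (weaken h d) (weaken h e)

closed : [] ⊢ φ → Γ ⊢ φ
closed = weaken (λ ())

w : Γ ⊢ φ → ψ ∷ Γ ⊢ φ
w = weaken there

conv : φ ≡ ψ → Γ ⊢ φ → Γ ⊢ ψ
conv refl d = d

-- From [] ⊢ ψ we get [] ⊢ ∀₁ ⋯ ∀₁ ψ, and instantiating N quantifiers from the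
-- outside realises every substitution that is a shift beyond N.
closed-sub : ∀ N σ → (∀ i → σ (N + i) ≡ var i) → ∀ ψ → [] ⊢ ψ → [] ⊢ subFm σ ψ
closed-sub zero σ h ψ d = conv (trans (sym (subFm-id ψ)) (subFm-cong (λ i → sym (h i)) ψ)) d
closed-sub (suc N) σ h ψ d =
  conv (trans (subFm-∘ _ _ ψ) (subFm-cong (λ { zero → refl ; (suc i) → inst-↑ (σ 0) (σ (suc i)) }) ψ))
       (∀₁E (closed-sub N (σ ∘ suc) h (∀₁ ψ) (∀₁I d)) (σ 0))

closed-ren : ∀ N ρ → (∀ i → ρ (N + i) ≡ i) → ∀ ψ → [] ⊢ ψ → [] ⊢ renFm₂ ρ ψ
closed-ren zero ρ h ψ d = conv (trans (sym (renFm₂-id ψ)) (renFm₂-cong (λ i → sym (h i)) ψ)) d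
closed-ren (suc N) ρ h ψ d =
  conv (trans (renFm₂-∘ _ _ ψ) (renFm₂-cong (λ { zero → refl ; (suc i) → refl }) ψ))
       (∀₂E (closed-ren N (ρ ∘ suc) h (∀₂ ψ) (∀₂I d)) (ρ 0))

infixr 1 _⇒*_
-- Discharging the whole context makes a derivation closed, the form that `closed-sub` and
-- `closed-ren` accept.
_⇒*_ : List Fm → Fm → Fm
[] ⇒* φ = φ
(γ ∷ Γ) ⇒* φ = Γ ⇒* (γ ⇒ φ)

⇒*I : ∀ Γ → Γ ⊢ φ → [] ⊢ Γ ⇒* φ
⇒*I [] d = d
⇒*I (γ ∷ Γ) d = ⇒*I Γ (⇒I d)

⇒*E : ∀ Γ → Δ ⊢ Γ ⇒* φ → (∀ {γ} → γ ∈ Γ → Δ ⊢ γ) → Δ ⊢ φ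
⇒*E [] d h = d
⇒*E (γ ∷ Γ) d h = ⇒E (⇒*E Γ d (h ∘ there)) (h (here refl))

subFm-⇒* : ∀ σ Γ φ → subFm σ (Γ ⇒* φ) ≡ (map (subFm σ) Γ ⇒* subFm σ φ)
subFm-⇒* σ [] φ = refl
subFm-⇒* σ (γ ∷ Γ) φ = subFm-⇒* σ Γ (γ ⇒ φ)

renFm₂-⇒* : ∀ ρ Γ φ → renFm₂ ρ (Γ ⇒* φ) ≡ (map (renFm₂ ρ) Γ ⇒* renFm₂ ρ φ)
renFm₂-⇒* ρ [] φ = refl
renFm₂-⇒* ρ (γ ∷ Γ) φ = renFm₂-⇒* ρ Γ (γ ⇒ φ)

-- Going through closed implications avoids an induction on derivations, which would break at `ax`:
-- the axioms are open formulas with fixed variables, and their substitution instances are not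
-- axioms.
sub-⊢ : ∀ N σ → (∀ i → σ (N + i) ≡ var i) → Γ ⊢ φ → map (subFm σ) Γ ⊢ subFm σ φ
sub-⊢ {Γ} {φ} N σ h d = ⇒*E (map (subFm σ) Γ)
  (closed (conv (subFm-⇒* σ Γ φ) (closed-sub N σ h _ (⇒*I Γ d)))) hyp

ren-⊢ : ∀ N ρ → (∀ i → ρ (N + i) ≡ i) → Γ ⊢ φ → map (renFm₂ ρ) Γ ⊢ renFm₂ ρ φ
ren-⊢ {Γ} {φ} N ρ h d = ⇒*E (map (renFm₂ ρ) Γ)
  (closed (conv (renFm₂-⇒* ρ Γ φ) (closed-ren N ρ h _ (⇒*I Γ d)))) hyp

splice : {A : Set} → ℕ → (f g : ℕ → A) → ℕ → A
splice zero f g = g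
splice (suc N) f g zero = f zero
splice (suc N) f g (suc i) = splice N (f ∘ suc) g i

splice-< : ∀ {A : Set} N {f g : ℕ → A} → Agree N (splice N f g) f
splice-< (suc N) zero p = refl
splice-< (suc N) (suc i) (s≤s p) = splice-< N i p

splice-+ : ∀ {A : Set} N {f g : ℕ → A} i → splice N f g (N + i) ≡ g i
splice-+ zero i = refl
splice-+ (suc N) i = splice-+ N i

splice-N : ∀ {A : Set} N {f g : ℕ → A} → splice N f g N ≡ g 0
splice-N zero = refl
splice-N (suc N) = splice-N N

-- Sends `i` below `N` to `suc i` and `N` to 0. From there on it restarts, with `suc N + i` going to
-- `i`: this is the shape demanded by `sub-⊢` and `ren-⊢`, and it does no harm because indices above
-- a fresh `N` do not occur.
rotate : ℕ → ℕ → ℕ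
rotate N = splice N suc pred

rotate-+ : ∀ N i → rotate N (suc N + i) ≡ i
rotate-+ N i = trans (cong (rotate N) (sym (+-suc N i))) (splice-+ N (suc i))

fvs fvs₂ : List Fm → ℕ
fvs [] = 0
fvs (γ ∷ Γ) = fv γ ⊔ fvs Γ
fvs₂ [] = 0
fvs₂ (γ ∷ Γ) = fv₂ γ ⊔ fvs₂ Γ

map-agree : ∀ Γ → Agree (fvs Γ) σ τ → map (subFm σ) Γ ≡ map (subFm τ) Γ
map-agree [] h = refl
map-agree (γ ∷ Γ) h = cong₂ _∷_ (subFm-agree γ (agreeˡ (fv γ) _ h)) (map-agree Γ (agreeʳ (fv γ) _ h))

map-agree₂ : ∀ Γ → Agree (fvs₂ Γ) ρ π → map (renFm₂ ρ) Γ ≡ map (renFm₂ π) Γ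
map-agree₂ [] h = refl
map-agree₂ (γ ∷ Γ) h = cong₂ _∷_ (renFm₂-agree γ (agreeˡ (fv₂ γ) _ h)) (map-agree₂ Γ (agreeʳ (fv₂ γ) _ h))

-- Here N is fresh for Γ and φ; rotating it to 0 turns sub₁ (var N) φ back into φ.
generic₁ : (∀ t → Γ ⊢ sub₁ t φ) → map ↑₁ Γ ⊢ φ
generic₁ {Γ} {φ} d = ≡-subst₂ _⊢_ ctx goal (sub-⊢ (suc N) r (λ i → cong var (rotate-+ N i)) (d (var N)))
  where
  N = fvs Γ ⊔ fv φ
  r : ℕ → Tm
  r = var ∘ rotate N
  ctx : map (subFm r) Γ ≡ map ↑₁ Γ
  ctx = map-agree Γ (λ i p → cong var (splice-< N i (≤-trans p (m≤m⊔n (fvs Γ) _))))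
  pt : ∀ i → i < fv φ → subTm r (inst₁ (var N) i) ≡ var i
  pt zero p = cong var (splice-N N)
  pt (suc i) p = cong var (splice-< N i (≤-trans (≤-trans (n≤1+n _) p) (m≤n⊔m (fvs Γ) _)))
  goal : subFm r (sub₁ (var N) φ) ≡ φ
  goal = trans (subFm-∘ _ _ φ) (trans (subFm-agree φ pt) (subFm-id φ))

generic₂ : (∀ j → Γ ⊢ sub₂ j φ) → map ↑₂ Γ ⊢ φ
generic₂ {Γ} {φ} d = ≡-subst₂ _⊢_ ctx goal (ren-⊢ (suc N) r (rotate-+ N) (d N))
  where
  N = fvs₂ Γ ⊔ fv₂ φ
  r : ℕ → ℕ
  r = rotate N
  ctx : map (renFm₂ r) Γ ≡ map ↑₂ Γ
  ctx = map-agree₂ Γ (λ i p → splice-< N i (≤-trans p (m≤m⊔n (fvs₂ Γ) _)))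
  pt : ∀ i → i < fv₂ φ → r (inst₂ N i) ≡ i
  pt zero p = splice-N N
  pt (suc i) p = splice-< N i (≤-trans (≤-trans (n≤1+n _) p) (m≤n⊔m (fvs₂ Γ) _))
  goal : renFm₂ r (sub₂ N φ) ≡ φ
  goal = trans (renFm₂-∘ _ _ φ) (trans (renFm₂-agree φ pt) (renFm₂-id φ))

∀₁I* : (∀ t → Γ ⊢ sub₁ t φ) → Γ ⊢ ∀₁ φ
∀₁I* d = ∀₁I (generic₁ d)

-- The family of continuations is packed into the single formula `φ ⇒ ↑₁ ψ`, whose instance at `t`
-- is `sub₁ t φ ⇒ ψ`, so `generic₁` applies to it.
∃₁E* : Γ ⊢ ∃₁ φ → (∀ t → sub₁ t φ ∷ Γ ⊢ ψ) → Γ ⊢ ψ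
∃₁E* {φ = φ} {ψ = ψ} d e = ∃₁E d (⇒E (w (generic₁ {φ = φ ⇒ ↑₁ ψ} (λ t → ⇒I (conv (sym (sub₁-↑₁ t ψ)) (e t))))) (hyp (here refl)))

∃₂E* : Γ ⊢ ∃₂ φ → (∀ j → sub₂ j φ ∷ Γ ⊢ ψ) → Γ ⊢ ψ
∃₂E* {φ = φ} {ψ = ψ} d e = ∃₂E d (⇒E (w (generic₂ {φ = φ ⇒ ↑₂ ψ} (λ t → ⇒I (conv (sym (sub₂-↑₂ t ψ)) (e t))))) (hyp (here refl)))

-- Classical propositional reasoning

infixl 5 _∙_
_∙_ : Γ ⊢ φ ⇒ ψ → Γ ⊢ φ → Γ ⊢ ψ
_∙_ = ⇒E

h0 : φ ∷ Γ ⊢ φ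
h0 = hyp (here refl)

h1 : ψ ∷ φ ∷ Γ ⊢ φ
h1 = w h0

h2 : χ ∷ ψ ∷ φ ∷ Γ ⊢ φ
h2 = w h1

h3 : θ ∷ χ ∷ ψ ∷ φ ∷ Γ ⊢ φ
h3 = w h2

w² : Γ ⊢ φ → χ ∷ ψ ∷ Γ ⊢ φ
w² = weaken (there ∘ there)

w³ : Γ ⊢ φ → θ ∷ χ ∷ ψ ∷ Γ ⊢ φ
w³ = weaken (there ∘ there ∘ there)

⊥E : Γ ⊢ ⊥' → Γ ⊢ φ
⊥E d = raa (w d)

em : ∀ φ → Γ ⊢ φ ∨' ¬' φ
em φ = raa (h0 ∙ ∨I₂ (⇒I (h1 ∙ ∨I₁ h0)))

byCases : ∀ φ → φ ∷ Γ ⊢ ψ → ¬' φ ∷ Γ ⊢ ψ → Γ ⊢ ψ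
byCases φ = ∨E (em φ)

-- A truth-table prover for propositional tautologies

data PF : Set where
  # : ℕ → PF
  ⊥ᵖ : PF
  _⇒ᵖ_ _∧ᵖ_ _∨ᵖ_ : PF → PF → PF

infixr 3 _∧ᵖ_ _xorᵖ_
infixr 2 _∨ᵖ_
infixr 1 _⇒ᵖ_ _⇔ᵖ_

¬ᵖ : PF → PF
¬ᵖ p = p ⇒ᵖ ⊥ᵖ

_⇔ᵖ_ _xorᵖ_ : PF → PF → PF
p ⇔ᵖ q = (p ⇒ᵖ q) ∧ᵖ (q ⇒ᵖ p)
p xorᵖ q = (p ∧ᵖ ¬ᵖ q) ∨ᵖ (¬ᵖ p ∧ᵖ q)

nth : {A : Set} → A → List A → ℕ → A
nth a [] i = a
nth a (b ∷ bs) zero = b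
nth a (b ∷ bs) (suc i) = nth a bs i

⟦_⟧ : PF → List Fm → Fm
⟦ # i ⟧ as = nth ⊥' as i
⟦ ⊥ᵖ ⟧ as = ⊥'
⟦ p ⇒ᵖ q ⟧ as = ⟦ p ⟧ as ⇒ ⟦ q ⟧ as
⟦ p ∧ᵖ q ⟧ as = ⟦ p ⟧ as ∧' ⟦ q ⟧ as
⟦ p ∨ᵖ q ⟧ as = ⟦ p ⟧ as ∨' ⟦ q ⟧ as

_→ᵇ_ : Bool → Bool → Bool
true →ᵇ b = b
false →ᵇ b = true

eval : PF → List Bool → Bool
eval (# i) bs = nth false bs i
eval ⊥ᵖ bs = false
eval (p ⇒ᵖ q) bs = eval p bs →ᵇ eval q bs
eval (p ∧ᵖ q) bs = eval p bs ∧ eval q bs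
eval (p ∨ᵖ q) bs = eval p bs ∨ eval q bs

lit : Bool → Fm → Fm
lit true φ = φ
lit false φ = ¬' φ

data Lits (Γ : List Fm) : List Bool → List Fm → Set where
  [] : Lits Γ [] []
  _∷_ : ∀ {b φ bs as} → Γ ⊢ lit b φ → Lits Γ bs as → Lits Γ (b ∷ bs) (φ ∷ as)

eval-nth : ∀ {bs as} → Lits Γ bs as → ∀ i → Γ ⊢ lit (nth false bs i) (nth ⊥' as i)
-- Past the end of the lists the defaults fit together: the atom is `⊥'`, its value `false`, and the
-- negation of `⊥'` is derivable.
eval-nth [] i = ⇒I h0
eval-nth (d ∷ ds) zero = d
eval-nth (d ∷ ds) (suc i) = eval-nth ds i

lit-⇒ : ∀ a b → Γ ⊢ lit a φ → Γ ⊢ lit b ψ → Γ ⊢ lit (a →ᵇ b) (φ ⇒ ψ)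
lit-⇒ true true d e = ⇒I (w e)
lit-⇒ true false d e = ⇒I (w e ∙ (h0 ∙ w d))
lit-⇒ false b d e = ⇒I (⊥E (w d ∙ h0))

lit-∧ : ∀ a b → Γ ⊢ lit a φ → Γ ⊢ lit b ψ → Γ ⊢ lit (a ∧ b) (φ ∧' ψ)
lit-∧ true true d e = ∧I d e
lit-∧ true false d e = ⇒I (w e ∙ ∧E₂ h0)
lit-∧ false b d e = ⇒I (w d ∙ ∧E₁ h0)

lit-∨ : ∀ a b → Γ ⊢ lit a φ → Γ ⊢ lit b ψ → Γ ⊢ lit (a ∨ b) (φ ∨' ψ)
lit-∨ true b d e = ∨I₁ d
lit-∨ false true d e = ∨I₂ e
lit-∨ false false d e = ⇒I (∨E h0 (w² d ∙ h0) (w² e ∙ h0))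

-- Kalmár's lemma, by induction on the formula: once the atoms are decided in a context, so is
-- everything built from them.
eval-sound : ∀ {bs as} → Lits Γ bs as → ∀ p → Γ ⊢ lit (eval p bs) (⟦ p ⟧ as)
eval-sound ls (# i) = eval-nth ls i
eval-sound ls ⊥ᵖ = ⇒I h0
eval-sound {bs = bs} ls (p ⇒ᵖ q) = lit-⇒ (eval p bs) (eval q bs) (eval-sound ls p) (eval-sound ls q)
eval-sound {bs = bs} ls (p ∧ᵖ q) = lit-∧ (eval p bs) (eval q bs) (eval-sound ls p) (eval-sound ls q)
eval-sound {bs = bs} ls (p ∨ᵖ q) = lit-∨ (eval p bs) (eval q bs) (eval-sound ls p) (eval-sound ls q)

allVals : ℕ → (List Bool → Bool) → Bool
allVals zero f = f []
allVals (suc n) f = allVals n (f ∘ (true ∷_)) ∧ allVals n (f ∘ (false ∷_))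

T-∧₁ : ∀ a b → T (a ∧ b) → T a
T-∧₁ true b h = _
T-∧₂ : ∀ a b → T (a ∧ b) → T b
T-∧₂ true b h = h

splitOn : ∀ as f → T (allVals (length as) f) →
  (∀ {Δ} bs → Γ ⊆ Δ → Lits Δ bs as → T (f bs) → Δ ⊢ φ) → Γ ⊢ φ
splitOn [] f h k = k [] id [] h
splitOn (a ∷ as) f h k = byCases a
  (splitOn as (f ∘ (true ∷_)) (T-∧₁ (allVals (length as) _) _ h)
    (λ bs i ls → k (true ∷ bs) (i ∘ there) (weaken i h0 ∷ ls)))
  (splitOn as (f ∘ (false ∷_)) (T-∧₂ (allVals (length as) _) _ h)
    (λ bs i ls → k (false ∷ bs) (i ∘ there) (weaken i h0 ∷ ls)))

lit-T : ∀ b → T b → Γ ⊢ lit b φ → Γ ⊢ φ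
lit-T true _ d = d

-- Excluded middle splits on all atoms and `eval-sound` closes each branch. The hidden argument is
-- the truth table itself: it evaluates to the unit type for a tautology and is then filled in by
-- the type checker. The atoms may be arbitrary formulas.
taut : ∀ as p {_ : T (allVals (length as) (eval p))} → Γ ⊢ ⟦ p ⟧ as
taut as p {h} = splitOn as (eval p) h (λ bs i ls e → lit-T (eval p bs) e (eval-sound ls p))

-- Bounded quantifiers and equality

∀≤E : Γ ⊢ ∀≤ t φ → ∀ u → Γ ⊢ u ≼ t → Γ ⊢ sub₁ u φ
∀≤E {t = t} d u e = ∀₁E d u ∙ conv (cong (u ≼_) (sym (inst-↑ u t))) e

∀≤I : (∀ u → (u ≼ t) ∷ Γ ⊢ sub₁ u φ) → Γ ⊢ ∀≤ t φ
∀≤I {t = t} d = ∀₁I* (λ u → ⇒I (≡-subst₂ _⊢_ (cong (λ z → (u ≼ z) ∷ _) (sym (inst-↑ u t))) refl (d u)))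

∃≤I : ∀ t u → Γ ⊢ u ≼ t → Γ ⊢ sub₁ u φ → Γ ⊢ ∃≤ t φ
∃≤I t u d e = ∃₁I u (∧I (conv (cong (u ≼_) (sym (inst-↑ u t))) d) e)

∃≤E : ∀ t → Γ ⊢ ∃≤ t φ → (∀ u → sub₁ u φ ∷ (u ≼ t) ∷ Γ ⊢ ψ) → Γ ⊢ ψ
∃≤E {φ = φ} t d e = ∃₁E* d (λ u →
  w (⇒I (⇒I (e u))) ∙ conv (cong (u ≼_) (inst-↑ u t)) (∧E₁ h0) ∙ ∧E₂ h0)

∀<'E : Γ ⊢ ∀<' t φ → ∀ u → Γ ⊢ u ≼ t → Γ ⊢ ¬' (u ≐ t) → Γ ⊢ sub₁ u φ
∀<'E {t = t} d u e f = ∀≤E d u e ∙ conv (cong (λ z → ¬' (u ≐ z)) (sym (inst-↑ u t))) f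

renFm₂-∀<' : ∀ ρ t φ → renFm₂ ρ (∀<' t φ) ≡ ∀<' (renTm₂ ρ t) (renFm₂ ρ φ)
renFm₂-∀<' ρ t φ rewrite renTm₂-subTm ρ (var ∘ suc) t = refl

-- `F` is a context as a function of the metalanguage, φ the same context with its hole at `var 0`.
-- Terms around the hole are shifted in φ, and the equation undoes the shift upon instantiation.
replace : ∀ (F : Tm → Fm) φ → (∀ t → sub₁ t φ ≡ F t) → Γ ⊢ s ≐ t → Γ ⊢ F s → Γ ⊢ F t
replace {s = s} {t = t} F φ h d e = conv (h t) (subst₁ φ d (conv (sym (h s)) e))

≐-sym : Γ ⊢ s ≐ t → Γ ⊢ t ≐ s
≐-sym {s = s} d = replace (_≐ s) (var 0 ≐ ↑ s) (λ t → cong (t ≐_) (inst-↑ t s)) d (refl₁ _)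

≐-trans : Γ ⊢ s ≐ t → Γ ⊢ t ≐ u → Γ ⊢ s ≐ u
≐-trans {s = s} d e = replace (s ≐_) (↑ s ≐ var 0) (λ t → cong (_≐ t) (inst-↑ t s)) e d

≼-substˡ : Γ ⊢ s ≐ t → Γ ⊢ s ≼ u → Γ ⊢ t ≼ u
≼-substˡ {u = u} = replace (_≼ u) (var 0 ≼ ↑ u) (λ t → cong (t ≼_) (inst-↑ t u))

≼-substʳ : Γ ⊢ s ≐ t → Γ ⊢ u ≼ s → Γ ⊢ u ≼ t
≼-substʳ {u = u} = replace (u ≼_) (↑ u ≼ var 0) (λ t → cong (_≼ t) (inst-↑ t u))

mem-subst : ∀ {X} → Γ ⊢ s ≐ t → Γ ⊢ mem s X → Γ ⊢ mem t X
mem-subst {X = X} = subst₁ (mem (var 0) X)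

⊕-cong : Γ ⊢ s ≐ t → Γ ⊢ u ≐ v → Γ ⊢ s ⊕ u ≐ t ⊕ v
⊕-cong {s = s} {t = t} {u = u} d e =
  replace (λ z → s ⊕ u ≐ t ⊕ z) (↑ (s ⊕ u) ≐ ↑ t ⊕ var 0)
    (λ z → cong₂ (λ a b → a ≐ b ⊕ z) (inst-↑ z (s ⊕ u)) (inst-↑ z t)) e
    (replace (λ z → s ⊕ u ≐ z ⊕ u) (↑ (s ⊕ u) ≐ var 0 ⊕ ↑ u)
      (λ z → cong₂ (λ a b → a ≐ z ⊕ b) (inst-↑ z (s ⊕ u)) (inst-↑ z u)) d (refl₁ _))

⊗-cong : Γ ⊢ s ≐ t → Γ ⊢ u ≐ v → Γ ⊢ s ⊗ u ≐ t ⊗ v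
⊗-cong {s = s} {t = t} {u = u} d e =
  replace (λ z → s ⊗ u ≐ t ⊗ z) (↑ (s ⊗ u) ≐ ↑ t ⊗ var 0)
    (λ z → cong₂ (λ a b → a ≐ b ⊗ z) (inst-↑ z (s ⊗ u)) (inst-↑ z t)) e
    (replace (λ z → s ⊗ u ≐ z ⊗ u) (↑ (s ⊗ u) ≐ var 0 ⊗ ↑ u)
      (λ z → cong₂ (λ a b → a ≐ z ⊗ b) (inst-↑ z (s ⊗ u)) (inst-↑ z u)) d (refl₁ _))

-- Axioms at arbitrary terms

_,,_ : Tm → Tm → ℕ → Tm
(s ,, t) zero = s
(s ,, t) (suc zero) = t
(s ,, t) (suc (suc i)) = var i

instAx : AxV⁰2 φ → ∀ s t → Γ ⊢ subFm (s ,, t) φ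
instAx a s t = closed (closed-sub 2 (s ,, t) (λ i → refl) _ (ax a))

instAx₂ : AxV⁰2 φ → ∀ X s t → Γ ⊢ subFm (s ,, t) (sub₂ X φ)
instAx₂ a X s t = closed (closed-sub 2 (s ,, t) (λ i → refl) _ (closed-ren 1 (inst₂ X) (λ i → refl) _ (ax a)))

suc≢0 : ∀ s → Γ ⊢ ¬' (s ⊕ one ≐ zer)
suc≢0 s = instAx B1 s zer

suc-inj : Γ ⊢ s ⊕ one ≐ t ⊕ one → Γ ⊢ s ≐ t
suc-inj {s = s} {t = t} d = instAx B2 s t ∙ d

≼-antisym : Γ ⊢ s ≼ t → Γ ⊢ t ≼ s → Γ ⊢ s ≐ t
≼-antisym {s = s} {t = t} d e = instAx B7 s t ∙ ∧I d e

≼-⊕ : ∀ s t → Γ ⊢ s ≼ s ⊕ t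
≼-⊕ s t = instAx B8 s t

zer≼ : ∀ s → Γ ⊢ zer ≼ s
zer≼ s = instAx B9 s zer

≼-total : ∀ s t → Γ ⊢ (s ≼ t) ∨' (t ≼ s)
≼-total s t = instAx B10 s t

≼-refl : ∀ s → Γ ⊢ s ≼ s
≼-refl s = ∨E (≼-total s s) h0 h0

≼⇒<suc : Γ ⊢ s ≼ t → Γ ⊢ s <' t ⊕ one
≼⇒<suc {s = s} {t = t} d = ∧E₁ (instAx B11 s t) ∙ d

<suc⇒≼ : Γ ⊢ s <' t ⊕ one → Γ ⊢ s ≼ t
<suc⇒≼ {s = s} {t = t} d = ∧E₂ (instAx B11 s t) ∙ d

≼zer : Γ ⊢ s ≼ zer → Γ ⊢ s ≐ zer
≼zer d = ≼-antisym d (zer≼ _)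

predE : Γ ⊢ ¬' (s ≐ zer) → (∀ u → (u ⊕ one ≐ s) ∷ Γ ⊢ ψ) → Γ ⊢ ψ
predE {s = s} d k = ∃≤E {φ = var 0 ⊕ one ≐ ↑ s} s (instAx B12 s zer ∙ d) (λ u →
  w² (⇒I (k u)) ∙ conv (cong (u ⊕ one ≐_) (inst-↑ u s)) h0)

≼suc-split : Γ ⊢ s ≼ t ⊕ one → Γ ⊢ (s ≼ t) ∨' (s ≐ t ⊕ one)
≼suc-split d = byCases _ (∨I₂ h0) (∨I₁ (<suc⇒≼ (∧I (w d) h0)))

<⇒suc≼ : Γ ⊢ s ≼ t → Γ ⊢ ¬' (s ≐ t) → Γ ⊢ s ⊕ one ≼ t
<⇒suc≼ {s = s} {t = t} d e = ∨E (≼-total (s ⊕ one) t) h0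
  (∨E (≼suc-split h0) (⊥E (w² e ∙ ≼-antisym (w² d) h0)) (≼-substʳ (≐-sym h0) (≼-refl _)))

suc≼suc : Γ ⊢ s ⊕ one ≼ t ⊕ one → Γ ⊢ s ≼ t
suc≼suc {s = s} {t = t} d = ∨E (≼-total s t) h0
  (∨E (≼suc-split (w d))
    (⊥E (∧E₂ (≼⇒<suc h1) ∙ ≼-antisym (∧E₁ (≼⇒<suc h1)) h0))
    (≼-substʳ (suc-inj h0) (≼-refl _)))

mem⇒<len : ∀ {X} → Γ ⊢ mem s X → Γ ⊢ s <' len X
mem⇒<len {s = s} {X = X} d = instAx₂ L1 X zer s ∙ d

last-mem : ∀ {X} → Γ ⊢ s ⊕ one ≐ len X → Γ ⊢ mem s X
last-mem {s = s} {X = X} d = instAx₂ L2 X zer s ∙ d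

-- Comprehension and induction

compF : ℕ → Tm → Fm → Fm
compF X t φ = (len X ≼ t) ∧' ∀<' t (mem (var 0) X ⇔ φ)

skip₁ : Fm → Fm
skip₁ = subFm (lift₁ (var ∘ suc))

-- The axiom has a variable as its bound and lets the formula mention it. `skip₁` inserts that
-- variable vacuously; generalising over it and instantiating with `t` yields an arbitrary bound
-- while φ keeps its own parameters.
comp-ax : ΣB₀ φ → ∀ t → Γ ⊢ ∃₂ ((len 0 ≼ renTm₂ suc t) ∧' ∀<' (renTm₂ suc t) (mem (var 0) 0 ⇔ ↑₂ φ))
comp-ax {φ = φ} sφ t = closed (conv (cong (λ z → ∃₂ ((len 0 ≼ renTm₂ suc t) ∧' ∀<' (renTm₂ suc t) (mem (var 0) 0 ⇔ z))) e)
    (∀₁E (∀₁I (ax (COMP (ΣB₀-sub (lift₁ (var ∘ suc)) sφ)))) t))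
  where
  σ' : ℕ → Tm
  σ' = lift₁ (λ i → renTm₂ suc (inst₁ t i))
  e : subFm σ' (↑₂ (skip₁ φ)) ≡ ↑₂ φ
  e = trans (cong (subFm σ') (renFm₂-subFm suc _ φ))
     (trans (subFm-∘ _ _ (↑₂ φ))
     (trans (subFm-cong (λ { zero → refl ; (suc i) → refl }) (↑₂ φ)) (subFm-id (↑₂ φ))))

compE : ∀ φ → ΣB₀ φ → ∀ t → (∀ X → compF X t φ ∷ Γ ⊢ ψ) → Γ ⊢ ψ
compE {Γ = Γ} {ψ = ψ} φ sφ t k = ∃₂E* (comp-ax sφ t) (λ X → ≡-subst₂ _⊢_ (cong (_∷ Γ) (sym (e X))) refl (k X))
  where
  e : ∀ X → sub₂ X ((len 0 ≼ renTm₂ suc t) ∧' ∀<' (renTm₂ suc t) (mem (var 0) 0 ⇔ ↑₂ φ)) ≡ compF X t φ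
  e X rewrite renFm₂-∀<' (inst₂ X) (renTm₂ suc t) (mem (var 0) 0 ⇔ ↑₂ φ) | inst₂-suc X t | sub₂-↑₂ X φ = refl

comp-iff : ∀ {X} → Γ ⊢ compF X t φ → ∀ u → Γ ⊢ u ≼ t → Γ ⊢ ¬' (u ≐ t) → Γ ⊢ mem u X ⇔ sub₁ u φ
comp-iff d = ∀<'E (∧E₂ d)

-- With Y = {z ≤ t : φ holds up to z}, a maximal element of Y below t contradicts the step.
induction : ∀ φ → ΣB₀ φ → Γ ⊢ sub₁ zer φ → (∀ u → sub₁ u φ ∷ Γ ⊢ sub₁ (u ⊕ one) φ) → ∀ t → Γ ⊢ sub₁ t φ
induction {Γ} φ sφ base step t = raa (compE upTo (ball (var 0) (ΣB₀-sub _ sφ)) (t ⊕ one) main)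
  where
  upTo : Fm
  upTo = ∀≤ (var 0) (skip₁ φ)
  upTo-sub : ∀ u → sub₁ u upTo ≡ ∀≤ u φ
  upTo-sub u = cong (∀≤ u) (trans (subFm-∘ _ _ φ)
    (trans (subFm-cong (λ { zero → refl ; (suc i) → refl }) φ) (subFm-id φ)))
  Ctx : ℕ → List Fm
  -- Comprehension decides membership only strictly below its bound, so `t ⊕ one` is taken in order
  -- to cover `t`.
  Ctx Y = compF Y (t ⊕ one) upTo ∷ ¬' (sub₁ t φ) ∷ Γ
  iff : ∀ Y → Ctx Y ⊆ Δ → ∀ u → Δ ⊢ u ≼ t → Δ ⊢ mem u Y ⇔ ∀≤ u φ
  iff Y i u d = conv (cong (mem u Y ⇔_) (upTo-sub u))
    (comp-iff (weaken i h0) u (∧E₁ (≼⇒<suc d)) (∧E₂ (≼⇒<suc d)))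
  main : ∀ Y → Ctx Y ⊢ ⊥'
  -- If `len Y` is 0, the base case puts 0 into `Y` although members lie below `len Y`. Otherwise
  -- the predecessor of `len Y` is the largest member.
  main Y = byCases (len Y ≐ zer)
    (∧E₂ (mem⇒<len
       (∧E₂ (iff Y there zer (zer≼ t)) ∙ ∀≤I (λ u → subst₁ φ (≐-sym (≼zer h0)) (w (w³ base)))))
     ∙ ≐-sym h0)
    (predE h0 (λ z →
      let z≼t = suc≼suc (≼-substˡ (≐-sym h0) (∧E₁ h2))
          upto : ∀ {χ} → χ ∷ (z ⊕ one ≐ len Y) ∷ ¬' (len Y ≐ zer) ∷ Ctx Y ⊢ ∀≤ z φ
          upto = w (∧E₁ (iff Y (there ∘ there) z z≼t) ∙ last-mem h0)
      in byCases (z ≐ t)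
        (w³ h1 ∙ subst₁ φ h0 (∀≤E upto z (≼-refl z)))
        (∧E₂ (mem⇒<len (∧E₂ (iff Y (there ∘ there ∘ there) (z ⊕ one) (<⇒suc≼ (w z≼t) h0))
            ∙ ∀≤I (λ u → ∨E (≼suc-split h0)
                (∀≤E (w² upto) u h0)
                (subst₁ φ (≐-sym h0) (w² (w³ (w² (⇒I (step z))) ∙ ∀≤E upto z (≼-refl z)))))))
         ∙ h1)))

inductionF : ∀ (F : Tm → Fm) φ → (∀ t → sub₁ t φ ≡ F t) → ΣB₀ φ →
  Γ ⊢ F zer → (∀ u → F u ∷ Γ ⊢ F (u ⊕ one)) → ∀ t → Γ ⊢ F t
inductionF {Γ} F φ h sφ base step t = conv (h t) (induction φ sφ (conv (sym (h zer)) base)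
  (λ u → ≡-subst₂ _⊢_ (cong (_∷ Γ) (sym (h u))) (sym (h (u ⊕ one))) (step u)) t)

-- Arithmetic

infixr 4 _⊚_
_⊚_ : Γ ⊢ s ≐ t → Γ ⊢ t ≐ u → Γ ⊢ s ≐ u
_⊚_ = ≐-trans

≐-refl : Γ ⊢ t ≐ t
≐-refl = refl₁ _

⊕-zer : ∀ s → Γ ⊢ s ⊕ zer ≐ s
⊕-zer s = instAx B3 s zer

⊕-suc : ∀ s t → Γ ⊢ s ⊕ (t ⊕ one) ≐ (s ⊕ t) ⊕ one
⊕-suc s t = instAx B4 s t

⊗-zer : ∀ s → Γ ⊢ s ⊗ zer ≐ zer
⊗-zer s = instAx B5 s zer

⊗-suc : ∀ s t → Γ ⊢ s ⊗ (t ⊕ one) ≐ (s ⊗ t) ⊕ s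
⊗-suc s t = instAx B6 s t

suc-cong : Γ ⊢ s ≐ t → Γ ⊢ s ⊕ one ≐ t ⊕ one
suc-cong e = ⊕-cong e ≐-refl

-- Allows induction with two parameters: they are shifted past the induction variable, and
-- instantiation removes the shift because `G` commutes with substitution, mostly by `refl`.
parametric : (G : Tm → Tm → Tm → Fm) → (∀ t y z → sub₁ t (G y z (var 0)) ≡ G (subTm (inst₁ t) y) (subTm (inst₁ t) z) t) →
  ∀ r s t → sub₁ t (G (↑ r) (↑ s) (var 0)) ≡ G r s t
parametric G h r s t = trans (h t (↑ r) (↑ s)) (cong₂ (λ y z → G y z t) (inst-↑ t r) (inst-↑ t s))

inductionP : (G : Tm → Tm → Tm → Fm) → (∀ t y z → sub₁ t (G y z (var 0)) ≡ G (subTm (inst₁ t) y) (subTm (inst₁ t) z) t) →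
  ∀ r s → ΣB₀ (G (↑ r) (↑ s) (var 0)) → Γ ⊢ G r s zer → (∀ u → G r s u ∷ Γ ⊢ G r s (u ⊕ one)) → ∀ t → Γ ⊢ G r s t
inductionP G h r s = inductionF (G r s) (G (↑ r) (↑ s) (var 0)) (parametric G h r s)

zer-⊕ : ∀ t → Γ ⊢ zer ⊕ t ≐ t
zer-⊕ = inductionP (λ _ _ t → zer ⊕ t ≐ t) (λ _ _ _ → refl) zer zer (eq _ _)
  (⊕-zer zer) (λ u → ⊕-suc _ _ ⊚ suc-cong h0)

suc-⊕ : ∀ s t → Γ ⊢ (s ⊕ one) ⊕ t ≐ (s ⊕ t) ⊕ one
suc-⊕ s = inductionP (λ _ s t → (s ⊕ one) ⊕ t ≐ (s ⊕ t) ⊕ one) (λ _ _ _ → refl) zer s (eq _ _)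
  (⊕-zer _ ⊚ suc-cong (≐-sym (⊕-zer _)))
  (λ u → ⊕-suc _ _ ⊚ suc-cong (h0 ⊚ ≐-sym (⊕-suc _ _)))

⊕-comm : ∀ s t → Γ ⊢ s ⊕ t ≐ t ⊕ s
⊕-comm s = inductionP (λ _ s t → s ⊕ t ≐ t ⊕ s) (λ _ _ _ → refl) zer s (eq _ _)
  (⊕-zer _ ⊚ ≐-sym (zer-⊕ _))
  (λ u → ⊕-suc _ _ ⊚ suc-cong h0 ⊚ ≐-sym (suc-⊕ _ _))

⊕-assoc : ∀ r s t → Γ ⊢ (r ⊕ s) ⊕ t ≐ r ⊕ (s ⊕ t)
⊕-assoc r s = inductionP (λ r s t → (r ⊕ s) ⊕ t ≐ r ⊕ (s ⊕ t)) (λ _ _ _ → refl) r s (eq _ _)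
  (⊕-zer _ ⊚ ⊕-cong ≐-refl (≐-sym (⊕-zer _)))
  (λ u → ⊕-suc _ _ ⊚ suc-cong h0 ⊚ ≐-sym (⊕-suc _ _) ⊚ ⊕-cong ≐-refl (≐-sym (⊕-suc _ _)))

zer-⊗ : ∀ t → Γ ⊢ zer ⊗ t ≐ zer
zer-⊗ = inductionP (λ _ _ t → zer ⊗ t ≐ zer) (λ _ _ _ → refl) zer zer (eq _ _)
  (⊗-zer zer) (λ u → ⊗-suc _ _ ⊚ ⊕-zer _ ⊚ h0)

⊕-swap : ∀ r s t → Γ ⊢ (r ⊕ s) ⊕ t ≐ (r ⊕ t) ⊕ s
⊕-swap r s t = ⊕-assoc r s t ⊚ ⊕-cong ≐-refl (⊕-comm s t) ⊚ ≐-sym (⊕-assoc r t s)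

suc-⊗ : ∀ s t → Γ ⊢ (s ⊕ one) ⊗ t ≐ (s ⊗ t) ⊕ t
suc-⊗ s = inductionP (λ _ s t → (s ⊕ one) ⊗ t ≐ (s ⊗ t) ⊕ t) (λ _ _ _ → refl) zer s (eq _ _)
  (⊗-zer _ ⊚ ≐-sym (⊕-zer _ ⊚ ⊗-zer _))
  (λ u → ⊗-suc _ _ ⊚ ⊕-cong h0 ≐-refl ⊚ ⊕-suc _ _
       ⊚ suc-cong (⊕-swap _ _ _ ⊚ ⊕-cong (≐-sym (⊗-suc _ _)) ≐-refl) ⊚ ≐-sym (⊕-suc _ _))

⊗-comm : ∀ s t → Γ ⊢ s ⊗ t ≐ t ⊗ s
⊗-comm s = inductionP (λ _ s t → s ⊗ t ≐ t ⊗ s) (λ _ _ _ → refl) zer s (eq _ _)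
  (⊗-zer _ ⊚ ≐-sym (zer-⊗ _))
  (λ u → ⊗-suc _ _ ⊚ ⊕-cong h0 ≐-refl ⊚ ≐-sym (suc-⊗ _ _))

⊗-distribˡ : ∀ r s t → Γ ⊢ r ⊗ (s ⊕ t) ≐ r ⊗ s ⊕ r ⊗ t
⊗-distribˡ r s = inductionP (λ r s t → r ⊗ (s ⊕ t) ≐ r ⊗ s ⊕ r ⊗ t) (λ _ _ _ → refl) r s (eq _ _)
  (⊗-cong ≐-refl (⊕-zer _) ⊚ ≐-sym (⊕-cong ≐-refl (⊗-zer _) ⊚ ⊕-zer _))
  (λ u → ⊗-cong ≐-refl (⊕-suc _ _) ⊚ ⊗-suc _ _ ⊚ ⊕-cong h0 ≐-refl ⊚ ⊕-assoc _ _ _ ⊚ ⊕-cong ≐-refl (≐-sym (⊗-suc _ _)))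

⊗-assoc : ∀ r s t → Γ ⊢ (r ⊗ s) ⊗ t ≐ r ⊗ (s ⊗ t)
⊗-assoc r s = inductionP (λ r s t → (r ⊗ s) ⊗ t ≐ r ⊗ (s ⊗ t)) (λ _ _ _ → refl) r s (eq _ _)
  (⊗-zer _ ⊚ ≐-sym (⊗-cong ≐-refl (⊗-zer _) ⊚ ⊗-zer _))
  (λ u → ⊗-suc _ _ ⊚ ⊕-cong h0 ≐-refl ⊚ ≐-sym (⊗-distribˡ _ _ _) ⊚ ⊗-cong ≐-refl (≐-sym (⊗-suc _ _)))

⊗-one : ∀ s → Γ ⊢ s ⊗ one ≐ s
⊗-one s = ⊗-cong ≐-refl (≐-sym (zer-⊕ one)) ⊚ ⊗-suc _ _ ⊚ ⊕-cong (⊗-zer _) ≐-refl ⊚ zer-⊕ _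

-- Equality is provability from the empty context, so a solved identity is a closed derivation and
-- enters other contexts through `closed`.
termSemiring : CommutativeSemiring 0ℓ 0ℓ
termSemiring = record
  { Carrier = Tm ; _≈_ = λ s t → [] ⊢ s ≐ t ; _+_ = _⊕_ ; _*_ = _⊗_ ; 0# = zer ; 1# = one
  ; isCommutativeSemiring = isCommutativeSemiringˡ record
    { +-isCommutativeMonoid = record
      { isMonoid = record
        { isSemigroup = record
          { isMagma = record { isEquivalence = equiv ; ∙-cong = ⊕-cong }
          ; assoc = ⊕-assoc }
        ; identity = zer-⊕ , ⊕-zer }
      ; comm = ⊕-comm }
    ; *-isCommutativeMonoid = record
      { isMonoid = record
        { isSemigroup = record
          { isMagma = record { isEquivalence = equiv ; ∙-cong = ⊗-cong }
          ; assoc = ⊗-assoc }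
        ; identity = (λ s → ⊗-comm one s ⊚ ⊗-one s) , ⊗-one }
      ; comm = ⊗-comm }
    ; distribʳ = λ r s t → ⊗-comm _ r ⊚ ⊗-distribˡ r s t ⊚ ⊕-cong (⊗-comm _ _) (⊗-comm _ _)
    ; zeroˡ = zer-⊗ } }
  where
  equiv : IsEquivalence (λ s t → [] ⊢ s ≐ t)
  equiv = record { refl = ≐-refl ; sym = ≐-sym ; trans = ≐-trans }

open NatSolver termSemiring using (solve; _:=_; _:+_; _:*_; con)

⊕-cancelʳ : ∀ u → Γ ⊢ s ⊕ u ≐ t ⊕ u → Γ ⊢ s ≐ t
⊕-cancelʳ {s = s} {t = t} u d = inductionP (λ s t u → (s ⊕ u ≐ t ⊕ u) ⇒ (s ≐ t)) (λ _ _ _ → refl) s t (imp (eq _ _) (eq _ _))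
  (⇒I (≐-sym (⊕-zer _) ⊚ h0 ⊚ ⊕-zer _))
  (λ v → ⇒I (h1 ∙ suc-inj (≐-sym (⊕-suc _ _) ⊚ h0 ⊚ ⊕-suc _ _))) u ∙ d

⊕-cancelˡ : ∀ u → Γ ⊢ u ⊕ s ≐ u ⊕ t → Γ ⊢ s ≐ t
⊕-cancelˡ u d = ⊕-cancelʳ u (⊕-comm _ _ ⊚ d ⊚ ⊕-comm _ _)

≢⊕suc : ∀ s t → Γ ⊢ s ≐ s ⊕ (t ⊕ one) → Γ ⊢ ⊥'
≢⊕suc s t d = suc≢0 t ∙ ⊕-cancelˡ s (≐-sym d ⊚ ≐-sym (⊕-zer s))

suc-mono : Γ ⊢ s ≼ t → Γ ⊢ s ⊕ one ≼ t ⊕ one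
suc-mono {s = s} {t = t} d = byCases (s ≐ t) (≼-substʳ (suc-cong h0) (≼-refl _))
  (∧E₁ (≼⇒<suc (<⇒suc≼ (w d) h0)))

-- The axioms give only `s ≼ s ⊕ u`; the difference is found by induction on `t`. Bounding it by `t`
-- makes the induction formula Σ^B_0.
≼-witness : ∀ s t → Γ ⊢ (s ≼ t) ⇒ ∃≤ t (↑ s ⊕ var 0 ≐ ↑ t)
≼-witness s = inductionF (λ t → (s ≼ t) ⇒ ∃≤ t (↑ s ⊕ var 0 ≐ ↑ t))
  ((↑ s ≼ var 0) ⇒ ∃≤ (var 0) (↑ (↑ s) ⊕ var 0 ≐ var 1)) h (imp (le _ _) (bex _ (eq _ _)))
  (⇒I (∃≤I zer zer (≼-refl _) (conv (sym (at zer zer)) (⊕-zer _ ⊚ ≼zer h0))))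
  (λ u → ⇒I (∨E (≼suc-split h0)
    (∃≤E {φ = ↑ s ⊕ var 0 ≐ ↑ u} u (w² h0 ∙ h0) (λ v → ∃≤I (u ⊕ one) (v ⊕ one)
      (suc-mono h1)
      (conv (sym (at (u ⊕ one) (v ⊕ one))) (⊕-suc _ _ ⊚ suc-cong (conv (at u v) h0)))))
    (∃≤I (u ⊕ one) zer (zer≼ _) (conv (sym (at (u ⊕ one) zer)) (⊕-zer _ ⊚ h0)))))
  where
  at : ∀ t v → sub₁ v (↑ s ⊕ var 0 ≐ ↑ t) ≡ (s ⊕ v ≐ t)
  at t v = cong₂ (λ a b → a ⊕ v ≐ b) (inst-↑ v s) (inst-↑ v t)
  h : ∀ t → sub₁ t ((↑ s ≼ var 0) ⇒ ∃≤ (var 0) (↑ (↑ s) ⊕ var 0 ≐ var 1)) ≡ ((s ≼ t) ⇒ ∃≤ t (↑ s ⊕ var 0 ≐ ↑ t))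
  h t rewrite subTm-lift-↑ (inst₁ t) (↑ s) | inst-↑ t s = refl

≼I : Γ ⊢ s ⊕ u ≐ t → Γ ⊢ s ≼ t
≼I d = ≼-substʳ d (≼-⊕ _ _)

≼E : Γ ⊢ s ≼ t → (∀ u → (s ⊕ u ≐ t) ∷ Γ ⊢ ψ) → Γ ⊢ ψ
≼E {s = s} {t = t} d k = ∃≤E t (≼-witness s t ∙ d) (λ u →
  w² (⇒I (k u)) ∙ conv (cong₂ (λ a b → a ⊕ u ≐ b) (inst-↑ u s) (inst-↑ u t)) h0)

≼-trans : Γ ⊢ s ≼ t → Γ ⊢ t ≼ u → Γ ⊢ s ≼ u
≼-trans d e = ≼E d (λ v → ≼E (w e) (λ v' → ≼I (≐-sym (⊕-assoc _ _ _) ⊚ ⊕-cong h1 ≐-refl ⊚ h0)))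

≼-or-suc≼ : ∀ s t → Γ ⊢ (s ≼ t) ∨' (t ⊕ one ≼ s)
≼-or-suc≼ s t = ∨E (≼-total s t) (∨I₁ h0) (byCases (t ≐ s)
  (∨I₁ (≼-substˡ h0 (≼-refl _))) (∨I₂ (<⇒suc≼ h1 h0)))

suc⋠ : Γ ⊢ s ⊕ one ≼ t → Γ ⊢ t ≼ s → Γ ⊢ ⊥'
suc⋠ {s = s} d e = ≼E (≼-trans d e) (λ v → ≢⊕suc s v (≐-sym h0 ⊚
  closed (solve 2 (λ s v → s :+ con 1 :+ v := s :+ (v :+ con 1)) ≐-refl s v)))

-- Naming the excess `v` reduces an inequality to a polynomial identity, which the solver brings
-- into the form refuted by `≢⊕suc`.
≼-via-⋡ : (∀ v → ((t ⊕ one) ⊕ v ≐ s) ∷ Γ ⊢ ⊥') → Γ ⊢ s ≼ t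
≼-via-⋡ k = ∨E (≼-or-suc≼ _ _) h0 (⊥E (≼E h0 (λ v → ⇒E (w² (⇒I (k v))) h0)))

-- Injectivity of pairing and uniqueness of division with remainder

pair-sum-≼ : Γ ⊢ pair a b ≐ pair c d → Γ ⊢ c ⊕ d ≼ a ⊕ b
pair-sum-≼ {a = a} {b = b} {c = c} {d = d} e = ≼-via-⋡ (λ v →
  -- One less than the excess of `pair c d` over `pair a b` when c + d = a + b + 1 + v. No
  -- subtraction is left in it, since 2(a + b) - 2b is 2a.
  ≢⊕suc (pair a b) (two ⊗ a ⊕ one ⊕ two ⊗ (a ⊕ b) ⊗ v ⊕ (one ⊕ one ⊕ one) ⊗ v ⊕ v ⊗ v ⊕ two ⊗ d)
    (w e ⊚ ⊕-cong (⊗-cong (≐-sym h0) (suc-cong (≐-sym h0))) ≐-refl ⊚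
     closed (solve 4 (λ a b v d →
        let 2' = con 1 :+ con 1 in
        (a :+ b :+ con 1 :+ v) :* (a :+ b :+ con 1 :+ v :+ con 1) :+ 2' :* d :=
        (a :+ b) :* (a :+ b :+ con 1) :+ 2' :* b :+
        (2' :* a :+ con 1 :+ 2' :* (a :+ b) :* v :+ (con 1 :+ con 1 :+ con 1) :* v :+ v :* v :+ 2' :* d :+ con 1))
        ≐-refl a b v d)))

double-≼ : Γ ⊢ two ⊗ s ≐ two ⊗ t → Γ ⊢ t ≼ s
double-≼ {s = s} {t = t} e = ≼-via-⋡ (λ v → ≢⊕suc (two ⊗ s) (two ⊗ v ⊕ one)
  (w e ⊚ ⊗-cong ≐-refl (≐-sym h0) ⊚
   closed (solve 2 (λ s v → let 2' = con 1 :+ con 1 in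
     2' :* (s :+ con 1 :+ v) := 2' :* s :+ (2' :* v :+ con 1 :+ con 1)) ≐-refl s v)))

-- Both pairs have the same coordinate sum, so the quadratic parts cancel and leave the doubled
-- second coordinates.
pair-injʳ : Γ ⊢ pair a b ≐ pair c d → Γ ⊢ b ≐ d
pair-injʳ {a = a} {b = b} {c = c} {d = d} e = ≼-antisym (double-≼ (≐-sym 2b≐2d)) (double-≼ 2b≐2d)
  where
  sum : _ ⊢ a ⊕ b ≐ c ⊕ d
  sum = ≼-antisym (pair-sum-≼ (≐-sym e)) (pair-sum-≼ e)
  2b≐2d = ⊕-cancelˡ ((a ⊕ b) ⊗ ((a ⊕ b) ⊕ one)) (e ⊚ ⊕-cong (≐-sym (⊗-cong sum (suc-cong sum))) ≐-refl)

pair-injˡ : Γ ⊢ pair a b ≐ pair c d → Γ ⊢ a ≐ c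
pair-injˡ {a = a} {b = b} {c = c} {d = d} e =
  ⊕-cancelʳ b (≼-antisym (pair-sum-≼ (≐-sym e)) (pair-sum-≼ e) ⊚ ⊕-cong ≐-refl (≐-sym (pair-injʳ e)))

-- Were c at least a + 1, the additional `m` on the right would already outweigh the remainder `b`
-- on the left.
divMod-≼ : ∀ {m} → Γ ⊢ b ⊕ one ≼ m → Γ ⊢ a ⊗ m ⊕ b ≐ c ⊗ m ⊕ d → Γ ⊢ c ≼ a
divMod-≼ {b = b} {a = a} {c = c} {d = d} {m = m} l e = ≼-via-⋡ (λ u → ≼E (w l) (λ v →
  ≢⊕suc (a ⊗ m ⊕ b) (v ⊕ u ⊗ m ⊕ d) (w² e ⊚ ⊕-cong (⊗-cong (≐-sym h1) ≐-refl) ≐-refl ⊚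
    closed (solve 4 (λ a m u d → (a :+ con 1 :+ u) :* m :+ d := a :* m :+ (m :+ (u :* m :+ d))) ≐-refl a m u d) ⊚
    ⊕-cong ≐-refl (⊕-cong (≐-sym h0) ≐-refl) ⊚
    closed (solve 6 (λ a m b v u d → a :* m :+ (b :+ con 1 :+ v :+ (u :* m :+ d)) := a :* m :+ b :+ (v :+ u :* m :+ d :+ con 1))
      ≐-refl a m b v u d))))

divMod-injˡ : ∀ {m} → Γ ⊢ b ⊕ one ≼ m → Γ ⊢ d ⊕ one ≼ m → Γ ⊢ a ⊗ m ⊕ b ≐ c ⊗ m ⊕ d → Γ ⊢ a ≐ c
divMod-injˡ l k e = ≼-antisym (divMod-≼ k (≐-sym e)) (divMod-≼ l e)

divMod-injʳ : ∀ {m} → Γ ⊢ b ⊕ one ≼ m → Γ ⊢ d ⊕ one ≼ m → Γ ⊢ a ⊗ m ⊕ b ≐ c ⊗ m ⊕ d → Γ ⊢ b ≐ d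
divMod-injʳ {a = a} {m = m} l k e = ⊕-cancelˡ (a ⊗ m) (e ⊚ ⊕-cong (⊗-cong (≐-sym (divMod-injˡ l k e)) ≐-refl) ≐-refl)

-- Quantification over grid points

inst² : Tm → Tm → ℕ → Tm
inst² a b zero = b
inst² a b (suc zero) = a
inst² a b (suc (suc i)) = var i

inst²-↑↑ : ∀ a b t → subTm (inst² a b) (↑ (↑ t)) ≡ t
inst²-↑↑ a b t = trans (cong (subTm _) (subTm-∘ _ _ t)) (trans (subTm-∘ _ _ t) (subTm-id t))

sub₁-sub₁ : ∀ a b φ → sub₁ b (subFm (lift₁ (inst₁ a)) φ) ≡ subFm (inst² a b) φ
sub₁-sub₁ a b φ = trans (subFm-∘ _ _ φ) (subFm-cong
  (λ { zero → refl ; (suc zero) → inst-↑ b a ; (suc (suc i)) → refl }) φ)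

sub-∀≤ : ∀ σ t φ → subFm σ (∀≤ t φ) ≡ ∀≤ (subTm σ t) (subFm (lift₁ σ) φ)
sub-∀≤ σ t φ = cong (λ z → ∀₁ ((var 0 ≼ z) ⇒ subFm (lift₁ σ) φ)) (subTm-lift-↑ σ t)

sub-∃≤ : ∀ σ t φ → subFm σ (∃≤ t φ) ≡ ∃≤ (subTm σ t) (subFm (lift₁ σ) φ)
sub-∃≤ σ t φ = cong (λ z → ∃₁ ((var 0 ≼ z) ∧' subFm (lift₁ σ) φ)) (subTm-lift-↑ σ t)

∀²E : ∀ n φ → Γ ⊢ ∀≤ n (∀≤ (↑ n) φ) → Γ ⊢ a ≼ n → Γ ⊢ b ≼ n → Γ ⊢ subFm (inst² a b) φ
∀²E {a = a} {b = b} n φ d e f = conv (sub₁-sub₁ a b φ)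
  (∀≤E (conv (trans (sub-∀≤ (inst₁ a) (↑ n) φ) (cong (λ z → ∀≤ z _) (inst-↑ a n))) (∀≤E d a e)) b f)

∃²I : ∀ n φ a b → Γ ⊢ a ≼ n → Γ ⊢ b ≼ n → Γ ⊢ subFm (inst² a b) φ → Γ ⊢ ∃≤ n (∃≤ (↑ n) φ)
∃²I n φ a b d e f = ∃≤I n a d
  (conv (sym (trans (sub-∃≤ (inst₁ a) (↑ n) φ) (cong (λ z → ∃≤ z _) (inst-↑ a n))))
    (∃≤I n b e (conv (sym (sub₁-sub₁ a b φ)) f)))

∃²E : ∀ n φ → Γ ⊢ ∃≤ n (∃≤ (↑ n) φ) →
  (∀ a b → subFm (inst² a b) φ ∷ (b ≼ n) ∷ (a ≼ n) ∷ Γ ⊢ ψ) → Γ ⊢ ψ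
∃²E n φ d k = ∃≤E n d (λ a → ∃≤E n
  (conv (trans (sub-∃≤ (inst₁ a) (↑ n) φ) (cong (λ z → ∃≤ z _) (inst-↑ a n))) h0) (λ b →
    w³ (w (⇒I (⇒I (⇒I (k a b))))) ∙ h3 ∙ h1 ∙ conv (sub₁-sub₁ a b φ) h0))

-- Neighbours and degrees

Subst³ : (Tm → Tm → Tm → Fm) → Set
Subst³ G = ∀ σ p a b → subFm σ (G p a b) ≡ G (subTm σ p) (subTm σ a) (subTm σ b)

replace³ : ∀ G → Subst³ G → ∀ p → Γ ⊢ a ≐ c → Γ ⊢ b ≐ d → Γ ⊢ G p a b → Γ ⊢ G p c d
replace³ {a = a} {c = c} {b = b} {d = d} G h p e f x =
  replace (G p c) (G (↑ p) (↑ c) (var 0))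
    (λ t → trans (h (inst₁ t) (↑ p) (↑ c) (var 0)) (cong₂ (λ y z → G y z t) (inst-↑ t p) (inst-↑ t c))) f
  (replace (λ z → G p z b) (G (↑ p) (var 0) (↑ b))
    (λ t → trans (h (inst₁ t) (↑ p) (var 0) (↑ b)) (cong₂ (λ y z → G y t z) (inst-↑ t p) (inst-↑ t b))) e x)

-- φ holds at the predecessor of a; false for a = 0.
prev : Tm → Fm → Fm
prev a φ = ∃≤ a ((var 0 ⊕ one ≐ ↑ a) ∧' φ)

prev-zer : Γ ⊢ a ≐ zer → Γ ⊢ ¬' (prev a φ)
prev-zer {a = a} e = ⇒I (∃≤E a h0 (λ u →
  suc≢0 u ∙ (conv (cong (u ⊕ one ≐_) (inst-↑ u a)) (∧E₁ h0) ⊚ w³ e)))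

prev-suc : ∀ φ → Γ ⊢ u ⊕ one ≐ a → Γ ⊢ prev a φ ⇔ sub₁ u φ
prev-suc {u = u} {a = a} φ e = ∧I
  (⇒I (∃≤E a h0 (λ v → subst₁ φ
    (suc-inj (conv (cong (v ⊕ one ≐_) (inst-↑ v a)) (∧E₁ h0) ⊚ ≐-sym (w³ e))) (∧E₂ h0))))
  (⇒I (∃≤I a u (≼I (w e)) (∧I (conv (cong (u ⊕ one ≐_) (sym (inst-↑ u a))) (w e)) h0)))

left-zer : ∀ E a b → Γ ⊢ a ≐ zer → Γ ⊢ ¬' (left E a b)
left-zer E a b = prev-zer {φ = mem (hEdge (var 0) (↑ b)) E}

down-zer : ∀ E a b → Γ ⊢ b ≐ zer → Γ ⊢ ¬' (down E a b)
down-zer E a b = prev-zer {φ = mem (vEdge (↑ a) (var 0)) E}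

left-suc : ∀ E u a b → Γ ⊢ u ⊕ one ≐ a → Γ ⊢ left E a b ⇔ right E u b
left-suc E u a b e = conv (cong (λ z → left E a b ⇔ right E u z) (inst-↑ u b))
  (prev-suc (mem (hEdge (var 0) (↑ b)) E) e)

down-suc : ∀ E a u b → Γ ⊢ u ⊕ one ≐ b → Γ ⊢ down E a b ⇔ up E a u
down-suc E a u b e = conv (cong (λ z → down E a b ⇔ up E z u) (inst-↑ u a))
  (prev-suc (mem (vEdge (↑ a) (var 0)) E) e)

sub-left : ∀ E σ a b → subFm σ (left E a b) ≡ left E (subTm σ a) (subTm σ b)
sub-left E σ a b = cong₂ (λ y z → ∃₁ ((var 0 ≼ y) ∧' ((var 0 ⊕ one ≐ y) ∧' mem (hEdge (var 0) z) E)))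
  (subTm-lift-↑ σ a) (subTm-lift-↑ σ b)

sub-down : ∀ E σ a b → subFm σ (down E a b) ≡ down E (subTm σ a) (subTm σ b)
sub-down E σ a b = cong₂ (λ y z → ∃₁ ((var 0 ≼ z) ∧' ((var 0 ⊕ one ≐ z) ∧' mem (vEdge y (var 0)) E)))
  (subTm-lift-↑ σ a) (subTm-lift-↑ σ b)

-- Interpreted at `edgesAt`, these return the degree formulas of the statement definitionally, which
-- lets `taut` look inside them.
deg0ᵖ deg1ᵖ deg2ᵖ degPosᵖ : (r l u d : PF) → PF
deg0ᵖ r l u d = ¬ᵖ r ∧ᵖ ¬ᵖ l ∧ᵖ ¬ᵖ u ∧ᵖ ¬ᵖ d
deg1ᵖ r l u d =
     (r ∧ᵖ ¬ᵖ l ∧ᵖ ¬ᵖ u ∧ᵖ ¬ᵖ d)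
  ∨ᵖ (¬ᵖ r ∧ᵖ l ∧ᵖ ¬ᵖ u ∧ᵖ ¬ᵖ d)
  ∨ᵖ (¬ᵖ r ∧ᵖ ¬ᵖ l ∧ᵖ u ∧ᵖ ¬ᵖ d)
  ∨ᵖ (¬ᵖ r ∧ᵖ ¬ᵖ l ∧ᵖ ¬ᵖ u ∧ᵖ d)
deg2ᵖ r l u d =
     (r ∧ᵖ l ∧ᵖ ¬ᵖ u ∧ᵖ ¬ᵖ d)
  ∨ᵖ (r ∧ᵖ ¬ᵖ l ∧ᵖ u ∧ᵖ ¬ᵖ d)
  ∨ᵖ (r ∧ᵖ ¬ᵖ l ∧ᵖ ¬ᵖ u ∧ᵖ d)
  ∨ᵖ (¬ᵖ r ∧ᵖ l ∧ᵖ u ∧ᵖ ¬ᵖ d)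
  ∨ᵖ (¬ᵖ r ∧ᵖ l ∧ᵖ ¬ᵖ u ∧ᵖ d)
  ∨ᵖ (¬ᵖ r ∧ᵖ ¬ᵖ l ∧ᵖ u ∧ᵖ d)
degPosᵖ r l u d = r ∨ᵖ l ∨ᵖ u ∨ᵖ d

edgesAt : ℕ → Tm → Tm → List Fm
edgesAt E a b = right E a b ∷ left E a b ∷ up E a b ∷ down E a b ∷ []

-- `right` and `up` commute with substitution by computation, whereas `left` and `down` contain a
-- bounded quantifier and need an equation.
sub-edges : ∀ p E σ a b → ⟦ p ⟧ (right E (subTm σ a) (subTm σ b) ∷ subFm σ (left E a b) ∷ up E (subTm σ a) (subTm σ b) ∷ subFm σ (down E a b) ∷ [])
  ≡ ⟦ p ⟧ (edgesAt E (subTm σ a) (subTm σ b))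
sub-edges p E σ a b = cong₂ (λ l d → ⟦ p ⟧ (right E (subTm σ a) (subTm σ b) ∷ l ∷ up E (subTm σ a) (subTm σ b) ∷ d ∷ []))
  (sub-left E σ a b) (sub-down E σ a b)

sub-deg0 : ∀ E σ a b → subFm σ (deg0 E a b) ≡ deg0 E (subTm σ a) (subTm σ b)
sub-deg0 = sub-edges (deg0ᵖ (# 0) (# 1) (# 2) (# 3))

sub-deg1 : ∀ E σ a b → subFm σ (deg1 E a b) ≡ deg1 E (subTm σ a) (subTm σ b)
sub-deg1 = sub-edges (deg1ᵖ (# 0) (# 1) (# 2) (# 3))

sub-deg2 : ∀ E σ a b → subFm σ (deg2 E a b) ≡ deg2 E (subTm σ a) (subTm σ b)
sub-deg2 = sub-edges (deg2ᵖ (# 0) (# 1) (# 2) (# 3))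

sub-degPos : ∀ E σ a b → subFm σ (degPos E a b) ≡ degPos E (subTm σ a) (subTm σ b)
sub-degPos = sub-edges (degPosᵖ (# 0) (# 1) (# 2) (# 3))

-- Parity of initial segments of grid columns

-- A two-digit number in base n + 1. Height n + 1 in column a has the index at which column a + 1
-- starts, so the columns are laid end to end.
idx : Tm → Tm → Tm → Tm
idx n a b = a ⊗ (n ⊕ one) ⊕ b

-- The parity of column a below b, read off a running parity Y of the concatenated columns.
odd : ℕ → Tm → Tm → Tm → Fm
odd Y n a b = mem (idx n a b) Y xor mem (a ⊗ (n ⊕ one)) Y

-- One formula serves both counts. For the edges of R, `C` is the parity that defines the colour;
-- for the edges of B it is empty, so every point has colour 0 and every horizontal edge counts.
bit : ℕ → ℕ → Tm → Tm → Tm → Fm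
bit E C n a b = right E a b ∧' ¬' (odd C n a b)

cell : ℕ → ℕ → Tm → Tm → Fm
cell E C n z = (z ≐ idx n (var 1) (var 0)) ∧' bit E C n (var 1) (var 0)

-- Comprehension sees only the number `z`. As division is not a term of the language, the
-- coordinates are recovered by a bounded search.
coded : ℕ → ℕ → Tm → Tm → Fm
coded E C n z = ∃≤ n (∃≤ (↑ n) (cell E C (↑ (↑ n)) (↑ (↑ z))))

ΣB₀-odd : ∀ Y n a b → ΣB₀ (odd Y n a b)
ΣB₀-odd Y n a b = disj (conj (mm _ _) (imp (mm _ _) bot)) (conj (imp (mm _ _) bot) (mm _ _))

ΣB₀-coded : ∀ E C n z → ΣB₀ (coded E C n z)
ΣB₀-coded E C n z = bex n (bex (↑ n) (conj (eq _ _) (conj (mm _ _) (imp (ΣB₀-odd C _ _ _) bot))))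

coded-sub : ∀ E C n u → sub₁ u (coded E C (↑ n) (var 0)) ≡ coded E C n u
coded-sub E C n u rewrite subTm-lift-↑ (lift₁ (inst₁ u)) (↑ (↑ n)) | subTm-lift-↑ (inst₁ u) (↑ n) | inst-↑ u n = refl

cell-sub : ∀ E C n u a b → subFm (inst² a b) (cell E C (↑ (↑ n)) (↑ (↑ u))) ≡ ((u ≐ idx n a b) ∧' bit E C n a b)
cell-sub E C n u a b rewrite inst²-↑↑ a b n | inst²-↑↑ a b u = refl

idx-≼ : Γ ⊢ a ≼ n → Γ ⊢ b ≼ n → Γ ⊢ idx n a b ≼ idx n n n
idx-≼ {a = a} {n = n} {b = b} d e = ≼E d (λ u → ≼E (w e) (λ v → ≼I {u = u ⊗ (n ⊕ one) ⊕ v}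
  (closed (solve 5 (λ a b m u v → a :* m :+ b :+ (u :* m :+ v) := (a :+ u) :* m :+ (b :+ v)) ≐-refl a b (n ⊕ one) u v)
   ⊚ ⊕-cong (⊗-cong h1 ≐-refl) h0)))

-- Any coordinates found by the search are the given ones, by uniqueness of division with remainder
-- by `n ⊕ one`.
coded-idx : ∀ E C → Γ ⊢ a ≼ n → Γ ⊢ b ≼ n → Γ ⊢ coded E C n (idx n a b) ⇔ bit E C n a b
coded-idx {a = a} {n = n} {b = b} E C d e = ∧I
  (⇒I (∃²E n body h0 (λ a' b' →
    let q = conv (cell-sub E C n (idx n a b) a' b') h0
        k = suc-mono (w³ (w e))
        l = suc-mono h1
    in replace³ (bit E C) (λ σ p a b → refl) n (≐-sym (divMod-injˡ k l (∧E₁ q))) (≐-sym (divMod-injʳ k l (∧E₁ q))) (∧E₂ q))))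
  (⇒I (∃²I n body a b (w d) (w e) (conv (sym (cell-sub E C n (idx n a b) a b)) (∧I ≐-refl h0))))
  where
  body : Fm
  body = cell E C (↑ (↑ n)) (↑ (↑ (idx n a b)))

parF : ℕ → ℕ → Tm → Fm
parF Y X t = ¬' (mem zer Y) ∧' ∀<' t (mem (var 0 ⊕ one) Y ⇔ (mem (var 0) Y xor mem (var 0) X))

parE : ∀ X t → (∀ Y → parF Y X t ∷ Γ ⊢ ψ) → Γ ⊢ ψ
parE {Γ} X t k = ∃₂E* (closed (closed-sub 1 (inst₁ t) (λ i → refl) _ (closed-ren 1 (inst₂ X) (λ i → refl) _ (ax PAR))))
  (λ Y → ≡-subst₂ _⊢_ (cong (_∷ Γ) (sym (e Y))) refl (k Y))
  where
  body : Fm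
  body = mem (var 0 ⊕ one) 0 ⇔ (mem (var 0) 0 xor mem (var 0) (suc X))
  e : ∀ Y → sub₂ Y (¬' (mem zer 0) ∧' ∀<' (renTm₂ suc t) body) ≡ parF Y X t
  e Y rewrite renFm₂-∀<' (inst₂ Y) (renTm₂ suc t) body | inst₂-suc Y t = refl

-- `X` holds the bits of all columns and `Y` their running parity. The bound is one past the index
-- of the last grid point, because both axioms speak of numbers strictly below their bound.
tallyF : ℕ → ℕ → ℕ → ℕ → Tm → Fm
tallyF X Y E C n = compF X (idx n n n ⊕ one) (coded E C (↑ n) (var 0)) ∧' parF Y X (idx n n n ⊕ one)

tallyE : ∀ E C n → (∀ X Y → tallyF X Y E C n ∷ Γ ⊢ ψ) → Γ ⊢ ψ
tallyE E C n k = compE (coded E C (↑ n) (var 0)) (ΣB₀-coded E C (↑ n) (var 0)) (idx n n n ⊕ one) (λ X →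
  parE X (idx n n n ⊕ one) (λ Y → w² (⇒I (k X Y)) ∙ ∧I h1 h0))

odd-zer : ∀ Y n a → Γ ⊢ ¬' (odd Y n a zer)
odd-zer Y n a = taut (mem (idx n a zer) Y ∷ mem (a ⊗ (n ⊕ one)) Y ∷ [])
  ((# 0 ⇒ᵖ # 1) ⇒ᵖ (# 1 ⇒ᵖ # 0) ⇒ᵖ ¬ᵖ (# 0 xorᵖ # 1))
  ∙ ⇒I (mem-subst (⊕-zer _) h0) ∙ ⇒I (mem-subst (≐-sym (⊕-zer _)) h0)

-- Both parities of the column are taken relative to the same starting value of `Y`, so the
-- recurrence of the parity axiom carries over.
odd-suc : ∀ {X} Y E C → Γ ⊢ tallyF X Y E C n → Γ ⊢ a ≼ n → Γ ⊢ b ≼ n →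
  Γ ⊢ odd Y n a (b ⊕ one) ⇔ (odd Y n a b xor bit E C n a b)
odd-suc {n = n} {a = a} {b = b} {X = X} Y E C t d e =
  taut (mem (idx n a (b ⊕ one)) Y ∷ mem (idx n a b ⊕ one) Y ∷ mem (idx n a b) Y ∷ mem (a ⊗ (n ⊕ one)) Y ∷
        mem (idx n a b) X ∷ coded E C n (idx n a b) ∷ bit E C n a b ∷ [])
    ((# 0 ⇒ᵖ # 1) ⇒ᵖ (# 1 ⇒ᵖ # 0) ⇒ᵖ (# 1 ⇔ᵖ (# 2 xorᵖ # 4)) ⇒ᵖ (# 4 ⇔ᵖ # 5) ⇒ᵖ (# 5 ⇔ᵖ # 6) ⇒ᵖ
     ((# 0 xorᵖ # 3) ⇔ᵖ ((# 2 xorᵖ # 3) xorᵖ # 6)))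
  ∙ ⇒I (mem-subst (⊕-suc _ _) h0) ∙ ⇒I (mem-subst (≐-sym (⊕-suc _ _)) h0)
  ∙ ∀<'E (∧E₂ (∧E₂ t)) (idx n a b) (∧E₁ lt) (∧E₂ lt)
  ∙ conv (cong (mem (idx n a b) X ⇔_) (coded-sub E C n (idx n a b))) (comp-iff (∧E₁ t) (idx n a b) (∧E₁ lt) (∧E₂ lt))
  ∙ coded-idx E C d e
  where
  lt : _ ⊢ idx n a b <' idx n n n ⊕ one
  lt = ≼⇒<suc (idx-≼ d e)

-- Colouring by B

even : ℕ → Tm → Tm → Fm
even E a b = deg0 E a b ∨' deg2 E a b

-- The colour odd Y n a b of the point (a,b) is the parity of the B-edges crossed by
-- a ray going down from (a,b), pushed slightly to the right.
module Colour (n : Tm) (B R Y : ℕ)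
  (even-B : ∀ a b → Γ ⊢ (a ≼ n) ⇒ (b ≼ n) ⇒ even B a b)
  (disjoint : ∀ a b → Γ ⊢ (a ≼ n) ⇒ (b ≼ n) ⇒ ¬' (degPos B a b ∧' degPos R a b))
  (colour-suc : ∀ a b → Γ ⊢ (a ≼ n) ⇒ (b ≼ n) ⇒ (odd Y n a (b ⊕ one) ⇔ (odd Y n a b xor right B a b)))
  where

  -- The right and left edges at (a + 1 , b) extend the two columns by one term each; as degrees
  -- are even, their sum is that of the up and down edges, so the column sums telescope.
  Crossing : (n a b : Tm) → Fm
  Crossing n a b = (a ⊕ one ≼ n) ⇒ (b ≼ n) ⇒ ((odd Y n (a ⊕ one) b xor odd Y n a b) ⇔ down B (a ⊕ one) b)

  sub-crossing : ∀ σ n a b → subFm σ (Crossing n a b) ≡ Crossing (subTm σ n) (subTm σ a) (subTm σ b)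
  sub-crossing σ n a b = cong (λ z →
    (subTm σ a ⊕ one ≼ subTm σ n) ⇒ (subTm σ b ≼ subTm σ n) ⇒
    ((odd Y (subTm σ n) (subTm σ a ⊕ one) (subTm σ b) xor odd Y (subTm σ n) (subTm σ a) (subTm σ b)) ⇔ z))
    (sub-down B σ (a ⊕ one) b)

  crossing : ∀ a b → Γ ⊢ Crossing n a b
  crossing a = inductionP Crossing (λ t n a → sub-crossing (inst₁ t) n a (var 0))
    n a
    (imp (le _ _) (imp (le _ _) (conj
      (imp (disj (conj odd₊ (imp odd₀ bot)) (conj (imp odd₊ bot) odd₀)) dn)
      (imp dn (disj (conj odd₊ (imp odd₀ bot)) (conj (imp odd₊ bot) odd₀))))))
    (⇒I (⇒I (taut (odd Y n (a ⊕ one) zer ∷ odd Y n a zer ∷ down B (a ⊕ one) zer ∷ [])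
      (¬ᵖ (# 0) ⇒ᵖ ¬ᵖ (# 1) ⇒ᵖ ¬ᵖ (# 2) ⇒ᵖ ((# 0 xorᵖ # 1) ⇔ᵖ # 2))
      ∙ odd-zer Y n (a ⊕ one) ∙ odd-zer Y n a ∙ down-zer B (a ⊕ one) zer ≐-refl)))
    (λ b → ⇒I (⇒I (let b≼n = ≼-trans (≼-⊕ b one) h0 in
      taut (odd Y n (a ⊕ one) (b ⊕ one) ∷ odd Y n (a ⊕ one) b ∷ odd Y n a (b ⊕ one) ∷ odd Y n a b ∷
            right B (a ⊕ one) b ∷ left B (a ⊕ one) b ∷ up B (a ⊕ one) b ∷ down B (a ⊕ one) b ∷
            right B a b ∷ down B (a ⊕ one) (b ⊕ one) ∷ [])
        ((# 9 ⇔ᵖ # 6) ⇒ᵖ (# 5 ⇔ᵖ # 8) ⇒ᵖ (# 0 ⇔ᵖ (# 1 xorᵖ # 4)) ⇒ᵖ (# 2 ⇔ᵖ (# 3 xorᵖ # 8)) ⇒ᵖ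
         ((# 1 xorᵖ # 3) ⇔ᵖ # 7) ⇒ᵖ (deg0ᵖ (# 4) (# 5) (# 6) (# 7) ∨ᵖ deg2ᵖ (# 4) (# 5) (# 6) (# 7)) ⇒ᵖ
         ((# 0 xorᵖ # 2) ⇔ᵖ # 9))
      ∙ down-suc B (a ⊕ one) b (b ⊕ one) ≐-refl
      ∙ left-suc B a (a ⊕ one) b ≐-refl
      ∙ (w³ (colour-suc (a ⊕ one) b) ∙ h1 ∙ b≼n)
      ∙ (w³ (colour-suc a b) ∙ ≼-trans (≼-⊕ a one) h1 ∙ b≼n)
      ∙ (h2 ∙ h1 ∙ b≼n)
      ∙ (w³ (even-B (a ⊕ one) b) ∙ h1 ∙ b≼n))))
    where
    odd₊ : ΣB₀ (odd Y (↑ n) (↑ a ⊕ one) (var 0))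
    odd₊ = ΣB₀-odd Y (↑ n) (↑ a ⊕ one) (var 0)
    odd₀ : ΣB₀ (odd Y (↑ n) (↑ a) (var 0))
    odd₀ = ΣB₀-odd Y (↑ n) (↑ a) (var 0)
    dn : ΣB₀ (down B (↑ a ⊕ one) (var 0))
    dn = bex (var 0) (conj (eq _ _) (mm _ _))

  -- The right endpoint carries an edge of R, hence by disjointness none of B, in particular none
  -- below it; then `crossing` equates the colours.
  colour-right : ∀ a b → Γ ⊢ (a ⊕ one ≼ n) ⇒ (b ≼ n) ⇒ right R a b ⇒ (odd Y n (a ⊕ one) b ⇔ odd Y n a b)
  colour-right a b = ⇒I (⇒I (⇒I (
    taut (odd Y n (a ⊕ one) b ∷ odd Y n a b ∷ right R a b ∷ left R (a ⊕ one) b ∷ right R (a ⊕ one) b ∷ up R (a ⊕ one) b ∷ down R (a ⊕ one) b ∷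
          right B (a ⊕ one) b ∷ left B (a ⊕ one) b ∷ up B (a ⊕ one) b ∷ down B (a ⊕ one) b ∷ [])
      (# 2 ⇒ᵖ (# 3 ⇔ᵖ # 2) ⇒ᵖ ¬ᵖ (degPosᵖ (# 7) (# 8) (# 9) (# 10) ∧ᵖ degPosᵖ (# 4) (# 3) (# 5) (# 6)) ⇒ᵖ
       ((# 0 xorᵖ # 1) ⇔ᵖ # 10) ⇒ᵖ (# 0 ⇔ᵖ # 1))
    ∙ h0 ∙ left-suc R a (a ⊕ one) b ≐-refl ∙ (w³ (disjoint (a ⊕ one) b) ∙ h2 ∙ h1) ∙ (w³ (crossing a b) ∙ h2 ∙ h1))))

  -- The colour could change only through the B-edge to the right of the lower endpoint, which lies
  -- on R and so meets no edge of B.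
  colour-up : ∀ a b → Γ ⊢ (a ≼ n) ⇒ (b ≼ n) ⇒ up R a b ⇒ (odd Y n a (b ⊕ one) ⇔ odd Y n a b)
  colour-up a b = ⇒I (⇒I (⇒I (
    taut (odd Y n a (b ⊕ one) ∷ odd Y n a b ∷ right R a b ∷ left R a b ∷ up R a b ∷ down R a b ∷
          right B a b ∷ left B a b ∷ up B a b ∷ down B a b ∷ [])
      (# 4 ⇒ᵖ ¬ᵖ (degPosᵖ (# 6) (# 7) (# 8) (# 9) ∧ᵖ degPosᵖ (# 2) (# 3) (# 4) (# 5)) ⇒ᵖ
       (# 0 ⇔ᵖ (# 1 xorᵖ # 6)) ⇒ᵖ (# 0 ⇔ᵖ # 1))
    ∙ h0 ∙ (w³ (disjoint a b) ∙ h2 ∙ h1) ∙ (w³ (colour-suc a b) ∙ h2 ∙ h1))))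

  -- Degree 0 at the outer points excludes vertical edges at the middle one, whose degree 2 thus
  -- comes from its left and right edges. The right one is the only edge counted between the two
  -- heights.
  colour-across : ∀ a b → Γ ⊢ a ≼ n → Γ ⊢ (b ⊕ one) ⊕ one ≼ n →
    Γ ⊢ deg0 B a b → Γ ⊢ deg2 B a (b ⊕ one) → Γ ⊢ deg0 B a ((b ⊕ one) ⊕ one) →
    Γ ⊢ odd Y n a ((b ⊕ one) ⊕ one) xor odd Y n a b
  colour-across a b a≼n b₂≼n below mid above =
    taut (odd Y n a ((b ⊕ one) ⊕ one) ∷ odd Y n a (b ⊕ one) ∷ odd Y n a b ∷ right B a b ∷ up B a b ∷
          right B a (b ⊕ one) ∷ left B a (b ⊕ one) ∷ up B a (b ⊕ one) ∷ down B a (b ⊕ one) ∷ down B a ((b ⊕ one) ⊕ one) ∷ [])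
      (¬ᵖ (# 3) ⇒ᵖ ¬ᵖ (# 4) ⇒ᵖ (# 8 ⇔ᵖ # 4) ⇒ᵖ ¬ᵖ (# 9) ⇒ᵖ (# 9 ⇔ᵖ # 7) ⇒ᵖ deg2ᵖ (# 5) (# 6) (# 7) (# 8) ⇒ᵖ
       (# 1 ⇔ᵖ (# 2 xorᵖ # 3)) ⇒ᵖ (# 0 ⇔ᵖ (# 1 xorᵖ # 5)) ⇒ᵖ (# 0 xorᵖ # 2))
    ∙ ∧E₁ below ∙ ∧E₁ (∧E₂ (∧E₂ below)) ∙ down-suc B a b (b ⊕ one) ≐-refl
    ∙ ∧E₂ (∧E₂ (∧E₂ above)) ∙ down-suc B a (b ⊕ one) ((b ⊕ one) ⊕ one) ≐-refl ∙ mid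
    ∙ (colour-suc a b ∙ a≼n ∙ ≼-trans (≼-⊕ b one) b₁≼n) ∙ (colour-suc a (b ⊕ one) ∙ a≼n ∙ b₁≼n)
    where
    b₁≼n : Γ ⊢ b ⊕ one ≼ n
    b₁≼n = ≼-trans (≼-⊕ (b ⊕ one) one) b₂≼n

-- Counting the edges of R by colour

split-≼ : ∀ s t → Γ ⊢ (s ≼ t ⊕ one) ⇔ ((s ≼ t) xor (t ⊕ one ≐ s))
split-≼ s t = taut ((s ≼ t ⊕ one) ∷ (s ≼ t) ∷ (t ⊕ one ≐ s) ∷ [])
  ((# 0 ⇒ᵖ (# 1 ∨ᵖ # 2)) ⇒ᵖ (# 1 ⇒ᵖ # 0) ⇒ᵖ (# 2 ⇒ᵖ # 0) ⇒ᵖ (# 2 ⇒ᵖ ¬ᵖ (# 1)) ⇒ᵖ (# 0 ⇔ᵖ (# 1 xorᵖ # 2)))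
  ∙ ⇒I (∨E (≼suc-split h0) (∨I₁ h0) (∨I₂ (≐-sym h0)))
  ∙ ⇒I (≼-trans h0 (≼-⊕ t one))
  ∙ ⇒I (≼-substˡ h0 (≼-refl _))
  ∙ ⇒I (⇒I (suc⋠ (≼-substʳ h1 (≼-refl _)) h0))

prevOdd : ℕ → Tm → Tm → Tm → Fm
prevOdd Y n a b = prev a (odd Y (↑ n) (var 0) (↑ b))

sub-prevOdd : ∀ Y → Subst³ (prevOdd Y)
sub-prevOdd Y σ n a b rewrite subTm-lift-↑ σ n | subTm-lift-↑ σ a | subTm-lift-↑ σ b = refl

prevOdd-suc : ∀ Y n u a b → Γ ⊢ u ⊕ one ≐ a → Γ ⊢ prevOdd Y n a b ⇔ odd Y n u b
prevOdd-suc Y n u a b e = conv (cong₂ (λ y z → prevOdd Y n a b ⇔ odd Y y u z) (inst-↑ u n) (inst-↑ u b))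
  (prev-suc (odd Y (↑ n) (var 0) (↑ b)) e)

prevOdd-zer : ∀ Y n a b → Γ ⊢ a ≐ zer → Γ ⊢ ¬' (prevOdd Y n a b)
prevOdd-zer Y n a b = prev-zer {φ = odd Y (↑ n) (var 0) (↑ b)}

-- (qa , qb) is the endpoint of R at which the colour odd Y is false, and odd Z counts the
-- horizontal R-edges starting at points of that colour.
module Count (n qa qb : Tm) (R Y Z : ℕ)
  (qa≼n : Γ ⊢ qa ≼ n) (qb≼n : Γ ⊢ qb ≼ n)
  (colour-right : ∀ a b → Γ ⊢ (a ⊕ one ≼ n) ⇒ (b ≼ n) ⇒ right R a b ⇒ (odd Y n (a ⊕ one) b ⇔ odd Y n a b))
  (colour-up : ∀ a b → Γ ⊢ (a ≼ n) ⇒ (b ≼ n) ⇒ up R a b ⇒ (odd Y n a (b ⊕ one) ⇔ odd Y n a b))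
  (count-suc : ∀ a b → Γ ⊢ (a ≼ n) ⇒ (b ≼ n) ⇒ (odd Z n a (b ⊕ one) ⇔ (odd Z n a b xor bit R Y n a b)))
  (no-right : ∀ b → Γ ⊢ ¬' (right R n b))
  (no-up : ∀ a → Γ ⊢ ¬' (up R a n))
  (odd-degree : ∀ a b → Γ ⊢ (a ≼ n) ⇒ (b ≼ n) ⇒
    (((right R a b xor left R a b xor up R a b xor down R a b) ∧' ¬' (odd Y n a b)) ⇔ ((a ≐ qa) ∧' (b ≐ qb))))
  where

  -- An edge entering column a from the left is counted by the colour of its left endpoint;
  -- `colour-right` allows the colour of its right endpoint instead.
  prev-count-suc : ∀ a b → Γ ⊢ (a ≼ n) ⇒ (b ≼ n) ⇒
    (prevOdd Z n a (b ⊕ one) ⇔ (prevOdd Z n a b xor (left R a b ∧' ¬' (odd Y n a b))))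
  prev-count-suc a b = ⇒I (⇒I (byCases (a ≐ zer)
    (taut (prevOdd Z n a (b ⊕ one) ∷ prevOdd Z n a b ∷ left R a b ∷ odd Y n a b ∷ [])
      (¬ᵖ (# 0) ⇒ᵖ ¬ᵖ (# 1) ⇒ᵖ ¬ᵖ (# 2) ⇒ᵖ (# 0 ⇔ᵖ (# 1 xorᵖ (# 2 ∧ᵖ ¬ᵖ (# 3)))))
      ∙ prevOdd-zer Z n a (b ⊕ one) h0 ∙ prevOdd-zer Z n a b h0 ∙ left-zer R a b h0)
    (predE h0 (λ u →
      let u+1≼n = ≼-substˡ (≐-sym h0) h3
          u≼n = ≼-trans (≼-⊕ u one) u+1≼n in
      taut (prevOdd Z n a (b ⊕ one) ∷ prevOdd Z n a b ∷ left R a b ∷ odd Y n a b ∷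
            odd Z n u (b ⊕ one) ∷ odd Z n u b ∷ right R u b ∷ odd Y n u b ∷ odd Y n (u ⊕ one) b ∷ [])
        ((# 0 ⇔ᵖ # 4) ⇒ᵖ (# 1 ⇔ᵖ # 5) ⇒ᵖ (# 2 ⇔ᵖ # 6) ⇒ᵖ (# 8 ⇒ᵖ # 3) ⇒ᵖ (# 3 ⇒ᵖ # 8) ⇒ᵖ
         (# 4 ⇔ᵖ (# 5 xorᵖ (# 6 ∧ᵖ ¬ᵖ (# 7)))) ⇒ᵖ (# 6 ⇒ᵖ (# 8 ⇔ᵖ # 7)) ⇒ᵖ
         (# 0 ⇔ᵖ (# 1 xorᵖ (# 2 ∧ᵖ ¬ᵖ (# 3)))))
      ∙ prevOdd-suc Z n u a (b ⊕ one) h0 ∙ prevOdd-suc Z n u a b h0 ∙ left-suc R u a b h0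
      ∙ ⇒I (replace³ (odd Y) (λ _ _ _ _ → refl) n h1 ≐-refl h0)
      ∙ ⇒I (replace³ (odd Y) (λ _ _ _ _ → refl) n (≐-sym h1) ≐-refl h0)
      ∙ (w² (w² (count-suc u b)) ∙ u≼n ∙ h2)
      ∙ (w² (w² (colour-right u b)) ∙ u+1≼n ∙ h2)))))

  -- The degree sum modulo 2 over the colour-0 points of column `a` below height `b`. Vertical edges
  -- inside cancel in pairs, the edge reaching up to height `b` survives, and q contributes once its
  -- row is below `b`.
  ColumnSum : (n a qa qb b : Tm) → Fm
  ColumnSum n a qa qb b = (odd Z n a b xor prevOdd Z n a b) ⇔
    ((down R a b ∧' ¬' (odd Y n a b)) xor ((a ≐ qa) ∧' (qb ⊕ one ≼ b)))

  -- Kept apart from the induction so that it also applies in the top row, where it leads to height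
  -- n + 1 outside the grid.
  columnSum-step : ∀ a b → Γ ⊢ (a ≼ n) ⇒ (b ≼ n) ⇒ ColumnSum n a qa qb b ⇒
    ((odd Z n a (b ⊕ one) xor prevOdd Z n a (b ⊕ one)) ⇔
      ((up R a b ∧' ¬' (odd Y n a (b ⊕ one))) xor ((a ≐ qa) ∧' (qb ⊕ one ≼ b ⊕ one))))
  columnSum-step a b = ⇒I (⇒I (⇒I (
    -- The coloured edges are atoms here and are opened only in the last premise, which keeps both
    -- truth tables at eleven atoms.
    taut (odd Z n a (b ⊕ one) ∷ prevOdd Z n a (b ⊕ one) ∷ (qb ⊕ one ≼ b ⊕ one) ∷ bit R Y n a b ∷ (left R a b ∧' ¬' (odd Y n a b)) ∷
          (qb ⊕ one ≼ b) ∷ (b ≐ qb) ∷ (a ≐ qa) ∷ (up R a b ∧' ¬' (odd Y n a (b ⊕ one))) ∷ odd Z n a b ∷ prevOdd Z n a b ∷ [])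
      ((# 0 ⇔ᵖ (# 9 xorᵖ # 3)) ⇒ᵖ (# 1 ⇔ᵖ (# 10 xorᵖ # 4)) ⇒ᵖ (# 2 ⇔ᵖ (# 5 xorᵖ # 6)) ⇒ᵖ
       (((# 9 xorᵖ # 3) xorᵖ (# 10 xorᵖ # 4)) ⇔ᵖ (# 8 xorᵖ (# 7 ∧ᵖ (# 5 xorᵖ # 6)))) ⇒ᵖ
       ((# 0 xorᵖ # 1) ⇔ᵖ (# 8 xorᵖ (# 7 ∧ᵖ # 2))))
    ∙ (w³ (count-suc a b) ∙ h2 ∙ h1)
    ∙ (w³ (prev-count-suc a b) ∙ h2 ∙ h1)
    ∙ (taut ((qb ⊕ one ≼ b ⊕ one) ∷ (qb ⊕ one ≼ b) ∷ (b ⊕ one ≐ qb ⊕ one) ∷ (b ≐ qb) ∷ [])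
        ((# 0 ⇔ᵖ (# 1 xorᵖ # 2)) ⇒ᵖ (# 2 ⇒ᵖ # 3) ⇒ᵖ (# 3 ⇒ᵖ # 2) ⇒ᵖ (# 0 ⇔ᵖ (# 1 xorᵖ # 3)))
       ∙ split-≼ (qb ⊕ one) b ∙ ⇒I (suc-inj h0) ∙ ⇒I (suc-cong h0))
    ∙ (taut (odd Z n a b ∷ prevOdd Z n a b ∷ right R a b ∷ left R a b ∷ up R a b ∷ down R a b ∷
             odd Y n a b ∷ odd Y n a (b ⊕ one) ∷ (a ≐ qa) ∷ (qb ⊕ one ≼ b) ∷ (b ≐ qb) ∷ [])
        (let r = # 2 ∧ᵖ ¬ᵖ (# 6)
             l = # 3 ∧ᵖ ¬ᵖ (# 6) in
         ((# 0 xorᵖ # 1) ⇔ᵖ ((# 5 ∧ᵖ ¬ᵖ (# 6)) xorᵖ (# 8 ∧ᵖ # 9))) ⇒ᵖ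
         (((# 2 xorᵖ # 3 xorᵖ # 4 xorᵖ # 5) ∧ᵖ ¬ᵖ (# 6)) ⇔ᵖ (# 8 ∧ᵖ # 10)) ⇒ᵖ
         (# 4 ⇒ᵖ (# 7 ⇔ᵖ # 6)) ⇒ᵖ
         (((# 0 xorᵖ r) xorᵖ (# 1 xorᵖ l)) ⇔ᵖ ((# 4 ∧ᵖ ¬ᵖ (# 7)) xorᵖ (# 8 ∧ᵖ (# 9 xorᵖ # 10)))))
       ∙ h0
       ∙ (w³ (odd-degree a b) ∙ h2 ∙ h1)
       ∙ (w³ (colour-up a b) ∙ h2 ∙ h1)))))

  sub-columnSum : ∀ σ n a qa qb b → subFm σ (ColumnSum n a qa qb b) ≡
    ColumnSum (subTm σ n) (subTm σ a) (subTm σ qa) (subTm σ qb) (subTm σ b)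
  sub-columnSum σ n a qa qb b rewrite sub-prevOdd Z σ n a b | sub-down R σ a b = refl

  columnSum : ∀ a b → Γ ⊢ (a ≼ n) ⇒ (b ≼ n) ⇒ ColumnSum n a qa qb b
  columnSum a = inductionF (λ b → (a ≼ n) ⇒ (b ≼ n) ⇒ ColumnSum n a qa qb b)
    ((↑ a ≼ ↑ n) ⇒ (var 0 ≼ ↑ n) ⇒ ColumnSum (↑ n) (↑ a) (↑ qa) (↑ qb) (var 0)) h
    (imp (le _ _) (imp (le _ _) (conj (imp lhs rhs) (imp rhs lhs))))
    (⇒I (⇒I (taut (odd Z n a zer ∷ prevOdd Z n a zer ∷ down R a zer ∷ odd Y n a zer ∷ (a ≐ qa) ∷ (qb ⊕ one ≼ zer) ∷ [])
      (¬ᵖ (# 0) ⇒ᵖ ¬ᵖ (# 1) ⇒ᵖ ¬ᵖ (# 2) ⇒ᵖ ¬ᵖ (# 5) ⇒ᵖ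
       ((# 0 xorᵖ # 1) ⇔ᵖ ((# 2 ∧ᵖ ¬ᵖ (# 3)) xorᵖ (# 4 ∧ᵖ # 5))))
      ∙ odd-zer Z n a
      ∙ byCases (a ≐ zer) (prevOdd-zer Z n a zer h0) (predE h0 (λ u →
          taut (prevOdd Z n a zer ∷ odd Z n u zer ∷ []) ((# 0 ⇔ᵖ # 1) ⇒ᵖ ¬ᵖ (# 1) ⇒ᵖ ¬ᵖ (# 0))
          ∙ prevOdd-suc Z n u a zer h0 ∙ odd-zer Z n u))
      ∙ down-zer R a zer ≐-refl
      ∙ ⇒I (suc≢0 qb ∙ ≼zer h0))))
    (λ b → ⇒I (⇒I (let b≼n = ≼-trans (≼-⊕ b one) h0 in
      taut ((odd Z n a (b ⊕ one) xor prevOdd Z n a (b ⊕ one)) ∷ down R a (b ⊕ one) ∷ up R a b ∷ odd Y n a (b ⊕ one) ∷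
            ((a ≐ qa) ∧' (qb ⊕ one ≼ b ⊕ one)) ∷ [])
        ((# 1 ⇔ᵖ # 2) ⇒ᵖ (# 0 ⇔ᵖ ((# 2 ∧ᵖ ¬ᵖ (# 3)) xorᵖ # 4)) ⇒ᵖ (# 0 ⇔ᵖ ((# 1 ∧ᵖ ¬ᵖ (# 3)) xorᵖ # 4)))
      ∙ down-suc R a b (b ⊕ one) ≐-refl
      ∙ (w³ (columnSum-step a b) ∙ h1 ∙ b≼n ∙ (h2 ∙ h1 ∙ b≼n)))))
    where
    h : ∀ t → sub₁ t ((↑ a ≼ ↑ n) ⇒ (var 0 ≼ ↑ n) ⇒ ColumnSum (↑ n) (↑ a) (↑ qa) (↑ qb) (var 0))
      ≡ ((a ≼ n) ⇒ (t ≼ n) ⇒ ColumnSum n a qa qb t)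
    h t rewrite sub-columnSum (inst₁ t) (↑ n) (↑ a) (↑ qa) (↑ qb) (var 0)
      | inst-↑ t n | inst-↑ t a | inst-↑ t qa | inst-↑ t qb = refl
    xorΣ : ∀ {φ ψ} → ΣB₀ φ → ΣB₀ ψ → ΣB₀ (φ xor ψ)
    xorΣ p q = disj (conj p (imp q bot)) (conj (imp p bot) q)
    lhs : ΣB₀ (odd Z (↑ n) (↑ a) (var 0) xor prevOdd Z (↑ n) (↑ a) (var 0))
    lhs = xorΣ (ΣB₀-odd Z (↑ n) (↑ a) (var 0)) (bex (↑ a) (conj (eq _ _) (ΣB₀-odd Z _ _ _)))
    rhs : ΣB₀ ((down R (↑ a) (var 0) ∧' ¬' (odd Y (↑ n) (↑ a) (var 0))) xor ((↑ a ≐ ↑ qa) ∧' (↑ qb ⊕ one ≼ var 0)))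
    rhs = xorΣ (conj (bex (var 0) (conj (eq _ _) (mm _ _))) (imp (ΣB₀-odd Y (↑ n) (↑ a) (var 0)) bot)) (conj (eq _ _) (le _ _))

  -- At height n + 1 the vertical term vanishes, as no edge of R leaves the top row, and the row of
  -- q has been passed.
  fullColumn : ∀ a → Γ ⊢ (a ≼ n) ⇒ ((odd Z n a (n ⊕ one) xor prevOdd Z n a (n ⊕ one)) ⇔ (a ≐ qa))
  fullColumn a = ⇒I (
    taut ((odd Z n a (n ⊕ one) xor prevOdd Z n a (n ⊕ one)) ∷ up R a n ∷ odd Y n a (n ⊕ one) ∷ (a ≐ qa) ∷ (qb ⊕ one ≼ n ⊕ one) ∷ [])
      (¬ᵖ (# 1) ⇒ᵖ # 4 ⇒ᵖ (# 0 ⇔ᵖ ((# 1 ∧ᵖ ¬ᵖ (# 2)) xorᵖ (# 3 ∧ᵖ # 4))) ⇒ᵖ (# 0 ⇔ᵖ # 3))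
    ∙ w (no-up a) ∙ w (suc-mono qb≼n)
    ∙ (w (columnSum-step a n) ∙ h0 ∙ ≼-refl n ∙ (w (columnSum a n) ∙ h0 ∙ ≼-refl n)))

  -- By `fullColumn` the parity changes between consecutive columns exactly at `qa`, starting from 0
  -- to the left of the grid.
  count-total : ∀ a → Γ ⊢ (a ≼ n) ⇒ (odd Z n a (n ⊕ one) ⇔ (qa ≼ a))
  count-total = inductionP (λ n qa a → (a ≼ n) ⇒ (odd Z n a (n ⊕ one) ⇔ (qa ≼ a))) (λ _ _ _ → refl) n qa
    (imp (le _ _) (conj (imp (ΣB₀-odd Z (↑ n) (var 0) (↑ n ⊕ one)) (le _ _)) (imp (le _ _) (ΣB₀-odd Z (↑ n) (var 0) (↑ n ⊕ one)))))
    (⇒I (taut (odd Z n zer (n ⊕ one) ∷ prevOdd Z n zer (n ⊕ one) ∷ (zer ≐ qa) ∷ (qa ≼ zer) ∷ [])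
      (¬ᵖ (# 1) ⇒ᵖ (# 2 ⇒ᵖ # 3) ⇒ᵖ (# 3 ⇒ᵖ # 2) ⇒ᵖ ((# 0 xorᵖ # 1) ⇔ᵖ # 2) ⇒ᵖ (# 0 ⇔ᵖ # 3))
      ∙ prevOdd-zer Z n zer (n ⊕ one) ≐-refl
      ∙ ⇒I (≼-substˡ h0 (≼-refl zer)) ∙ ⇒I (≐-sym (≼zer h0))
      ∙ (w (fullColumn zer) ∙ h0)))
    (λ a → ⇒I (
      taut (odd Z n (a ⊕ one) (n ⊕ one) ∷ prevOdd Z n (a ⊕ one) (n ⊕ one) ∷ odd Z n a (n ⊕ one) ∷
            (a ⊕ one ≐ qa) ∷ (qa ≼ a) ∷ (qa ≼ a ⊕ one) ∷ [])
        ((# 1 ⇔ᵖ # 2) ⇒ᵖ (# 5 ⇔ᵖ (# 4 xorᵖ # 3)) ⇒ᵖ (# 2 ⇔ᵖ # 4) ⇒ᵖ ((# 0 xorᵖ # 1) ⇔ᵖ # 3) ⇒ᵖ (# 0 ⇔ᵖ # 5))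
      ∙ prevOdd-suc Z n a (a ⊕ one) (n ⊕ one) ≐-refl
      ∙ split-≼ qa a
      ∙ (h1 ∙ ≼-trans (≼-⊕ a one) h0)
      ∙ (w² (fullColumn (a ⊕ one)) ∙ h0)))

  last-column : ∀ b → Γ ⊢ (b ≼ n ⊕ one) ⇒ ¬' (odd Z n n b)
  last-column = inductionP (λ n _ b → (b ≼ n ⊕ one) ⇒ ¬' (odd Z n n b)) (λ _ _ _ → refl) n n
    (imp (le _ _) (imp (ΣB₀-odd Z (↑ n) (↑ n) (var 0)) bot))
    (⇒I (odd-zer Z n n))
    (λ b → ⇒I (
      taut (odd Z n n (b ⊕ one) ∷ odd Z n n b ∷ right R n b ∷ odd Y n n b ∷ [])
        (¬ᵖ (# 1) ⇒ᵖ ¬ᵖ (# 2) ⇒ᵖ (# 0 ⇔ᵖ (# 1 xorᵖ (# 2 ∧ᵖ ¬ᵖ (# 3)))) ⇒ᵖ ¬ᵖ (# 0))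
      ∙ (h1 ∙ ≼-trans (≼-⊕ b one) h0)
      ∙ w² (no-right b)
      ∙ (w² (count-suc n b) ∙ ≼-refl n ∙ suc≼suc h0)))

  contradiction : Γ ⊢ ⊥'
  contradiction = last-column (n ⊕ one) ∙ ≼-refl _ ∙ (∧E₂ (count-total n ∙ ≼-refl n) ∙ qa≼n)

-- Boundary and endpoints

EdgeAt : (n e a b : Tm) → Fm
EdgeAt n e a b = ((a ⊕ one ≼ n) ∧' (e ≐ hEdge a b)) ∨' ((b ⊕ one ≼ n) ∧' (e ≐ vEdge a b))

isGridEdge-sub : ∀ n e → sub₁ e (isGridEdge (↑ n) (var 0)) ≡ isGridEdge n e
isGridEdge-sub n e rewrite subTm-lift-↑ (lift₁ (inst₁ e)) (↑ (↑ n)) | subTm-lift-↑ (inst₁ e) (↑ n) | inst-↑ e n = refl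

edgeSetE : ∀ n R → Γ ⊢ edgeSet n R → Γ ⊢ mem s R →
  (∀ a b → EdgeAt n s a b ∷ (b ≼ n) ∷ (a ≼ n) ∷ Γ ⊢ ψ) → Γ ⊢ ψ
edgeSetE {Γ = Γ} {s = s} n R d m k =
  ∃²E n (EdgeAt (↑ (↑ n)) (↑ (↑ s)) (var 1) (var 0))
    (conv (isGridEdge-sub n s) (∀≤E d s (∧E₁ (mem⇒<len m)) ∙ m))
    (λ a b → ≡-subst₂ _⊢_
      (cong (_∷ ((b ≼ n) ∷ (a ≼ n) ∷ Γ)) (sym (cong₂ (λ y z → EdgeAt y z a b) (inst²-↑↑ a b n) (inst²-↑↑ a b s)))) refl (k a b))

-- Decoding the edge by injectivity of pairing, a horizontal one would start in column n and end
-- within the grid, and a vertical one would have both n and n + 1 as its column.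
no-right-at-border : ∀ R → Γ ⊢ edgeSet n R → ∀ b → Γ ⊢ ¬' (right R n b)
no-right-at-border {n = n} R d b = ⇒I (edgeSetE n R (w d) h0 (λ a' b' → ∨E h0
  (suc⋠ (∧E₁ h0) (≼-substʳ (pair-injˡ (pair-injˡ (∧E₂ h0))) (≼-refl n)))
  (suc⋠ (≼-substʳ (pair-injˡ (pair-injʳ (∧E₂ h0))) (≼-refl (n ⊕ one)))
        (≼-substˡ (pair-injˡ (pair-injˡ (∧E₂ h0))) (≼-refl n)))))

no-up-at-border : ∀ R → Γ ⊢ edgeSet n R → ∀ a → Γ ⊢ ¬' (up R a n)
no-up-at-border {n = n} R d a = ⇒I (edgeSetE n R (w d) h0 (λ a' b' → ∨E h0
  (suc⋠ (≼-substʳ (pair-injʳ (pair-injʳ (∧E₂ h0))) (≼-refl (n ⊕ one)))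
        (≼-substˡ (pair-injʳ (pair-injˡ (∧E₂ h0))) (≼-refl n)))
  (suc⋠ (∧E₁ h0) (≼-substʳ (pair-injʳ (pair-injˡ (∧E₂ h0))) (≼-refl n)))))

-- All odd degrees of R occur at q and r, and r has colour 1, so q is the only colour-0 point of odd
-- degree; this is what `Count` requires.
no-path : ∀ n R Y qa qb ra rb →
  (∀ a b → Γ ⊢ (a ⊕ one ≼ n) ⇒ (b ≼ n) ⇒ right R a b ⇒ (odd Y n (a ⊕ one) b ⇔ odd Y n a b)) →
  (∀ a b → Γ ⊢ (a ≼ n) ⇒ (b ≼ n) ⇒ up R a b ⇒ (odd Y n a (b ⊕ one) ⇔ odd Y n a b)) →
  Γ ⊢ edgeSet n R → Γ ⊢ qa ≼ n → Γ ⊢ qb ≼ n → Γ ⊢ deg1 R qa qb → Γ ⊢ deg1 R ra rb →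
  (∀ a b → Γ ⊢ (a ≼ n) ⇒ (b ≼ n) ⇒ ¬' ((a ≐ qa) ∧' (b ≐ qb)) ⇒ ¬' ((a ≐ ra) ∧' (b ≐ rb)) ⇒ even R a b) →
  Γ ⊢ ¬' (odd Y n qa qb) ⇒ odd Y n ra rb ⇒ ⊥'
no-path n R Y qa qb ra rb colour-right colour-up edges qa≼n qb≼n deg-q deg-r even-R =
  ⇒I (⇒I (tallyE R Y n (λ X Z → Count.contradiction n qa qb R Y Z
    (w³ qa≼n) (w³ qb≼n) (λ a b → w³ (colour-right a b)) (λ a b → w³ (colour-up a b))
    (λ a b → ⇒I (⇒I (odd-suc Z R Y h2 h1 h0)))
    (no-right-at-border R (w³ edges)) (no-up-at-border R (w³ edges))
    (λ a b → ⇒I (⇒I (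
      taut (right R a b ∷ left R a b ∷ up R a b ∷ down R a b ∷ odd Y n a b ∷ (a ≐ qa) ∷ (b ≐ qb) ∷ ((a ≐ ra) ∧' (b ≐ rb)) ∷ [])
        (let r = # 0 ; l = # 1 ; u = # 2 ; d = # 3 in
         (# 5 ∧ᵖ # 6 ⇒ᵖ deg1ᵖ r l u d) ⇒ᵖ (# 7 ⇒ᵖ # 4) ⇒ᵖ (# 5 ∧ᵖ # 6 ⇒ᵖ ¬ᵖ (# 4)) ⇒ᵖ
         (¬ᵖ (# 5 ∧ᵖ # 6) ⇒ᵖ ¬ᵖ (# 7) ⇒ᵖ deg0ᵖ r l u d ∨ᵖ deg2ᵖ r l u d) ⇒ᵖ
         (((r xorᵖ l xorᵖ u xorᵖ d) ∧ᵖ ¬ᵖ (# 4)) ⇔ᵖ (# 5 ∧ᵖ # 6)))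
      ∙ ⇒I (replace³ (λ _ → deg1 R) (λ σ _ → sub-deg1 R σ) n (≐-sym (∧E₁ h0)) (≐-sym (∧E₂ h0)) (w³ (w³ deg-q)))
      ∙ ⇒I (replace³ (odd Y) (λ _ _ _ _ → refl) n (≐-sym (∧E₁ h0)) (≐-sym (∧E₂ h0)) (w³ h1))
      ∙ ⇒I (⇒I (w³ h3 ∙ replace³ (odd Y) (λ _ _ _ _ → refl) n (∧E₁ h1) (∧E₂ h1) h0))
      ∙ (w³ (w² (even-R a b)) ∙ h1 ∙ h0)))))))

disjoint⇒⊥ : ∀ n B R a₁ b₁ a₂ b₂ → Γ ⊢ a₁ ≼ n → Γ ⊢ b₁ ≼ n → Γ ⊢ a₂ ≼ n → Γ ⊢ b₂ ≼ n →
  Γ ⊢ a₂ ≐ a₁ → Γ ⊢ b₂ ≐ b₁ ⊕ two → Γ ⊢ deg0 B a₁ b₁ → Γ ⊢ deg2 B a₁ (b₁ ⊕ one) → Γ ⊢ deg0 B a₂ b₂ →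
  Γ ⊢ edgeSet n R → Γ ⊢ deg1 R a₁ b₁ → Γ ⊢ deg1 R a₂ b₂ →
  (∀ a b → Γ ⊢ (a ≼ n) ⇒ (b ≼ n) ⇒ even B a b) →
  (∀ a b → Γ ⊢ (a ≼ n) ⇒ (b ≼ n) ⇒ ¬' ((a ≐ a₁) ∧' (b ≐ b₁)) ⇒ ¬' ((a ≐ a₂) ∧' (b ≐ b₂)) ⇒ even R a b) →
  (∀ a b → Γ ⊢ (a ≼ n) ⇒ (b ≼ n) ⇒ ¬' (degPos B a b ∧' degPos R a b)) → Γ ⊢ ⊥'
disjoint⇒⊥ {Γ} n B R a₁ b₁ a₂ b₂ a₁≼n b₁≼n a₂≼n b₂≼n a₂≐a₁ b₂≐ below mid above edges end₁ end₂ even-B even-R disjoint =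
  -- `C` has length 0, hence is empty, and the tally of B by `C` counts all horizontal edges.
  compE ⊥' bot zer (λ C → tallyE B C n (λ X Y → main C X Y))
  where
  module _ (C X Y : ℕ) where
    Γ⁺ : List Fm
    Γ⁺ = tallyF X Y B C n ∷ compF C zer ⊥' ∷ Γ

    empty : ∀ u → Γ⁺ ⊢ ¬' (mem u C)
    empty u = ⇒I (∧E₂ (mem⇒<len h0) ∙
      ≼-antisym (∧E₁ (mem⇒<len h0)) (≼-trans (∧E₁ h2) (zer≼ u)))

    colour-suc : ∀ a b → Γ⁺ ⊢ (a ≼ n) ⇒ (b ≼ n) ⇒ (odd Y n a (b ⊕ one) ⇔ (odd Y n a b xor right B a b))
    colour-suc a b = ⇒I (⇒I (
      taut (odd Y n a (b ⊕ one) ∷ odd Y n a b ∷ right B a b ∷ mem (idx n a b) C ∷ mem (a ⊗ (n ⊕ one)) C ∷ [])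
        (¬ᵖ (# 3) ⇒ᵖ ¬ᵖ (# 4) ⇒ᵖ (# 0 ⇔ᵖ (# 1 xorᵖ (# 2 ∧ᵖ ¬ᵖ (# 3 xorᵖ # 4)))) ⇒ᵖ (# 0 ⇔ᵖ (# 1 xorᵖ # 2)))
      ∙ w² (empty _) ∙ w² (empty _) ∙ odd-suc Y B C h2 h1 h0))

    open Colour {Γ = Γ⁺} n B R Y (λ a b → w² (even-B a b)) (λ a b → w² (disjoint a b)) colour-suc

    b₂≐b₁+1+1 : Γ⁺ ⊢ b₂ ≐ (b₁ ⊕ one) ⊕ one
    b₂≐b₁+1+1 = w² b₂≐ ⊚ ⊕-suc b₁ one

    opposite : Γ⁺ ⊢ odd Y n a₁ b₁ xor odd Y n a₂ b₂
    opposite =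
      taut (odd Y n a₂ b₂ ∷ odd Y n a₁ ((b₁ ⊕ one) ⊕ one) ∷ odd Y n a₁ b₁ ∷ [])
        ((# 1 ⇒ᵖ # 0) ⇒ᵖ (# 0 ⇒ᵖ # 1) ⇒ᵖ (# 1 xorᵖ # 2) ⇒ᵖ (# 2 xorᵖ # 0))
      ∙ ⇒I (replace³ (odd Y) (λ _ _ _ _ → refl) n (w (≐-sym (w² a₂≐a₁))) (w (≐-sym b₂≐b₁+1+1)) h0)
      ∙ ⇒I (replace³ (odd Y) (λ _ _ _ _ → refl) n (w (w² a₂≐a₁)) (w b₂≐b₁+1+1) h0)
      ∙ colour-across a₁ b₁ (w² a₁≼n) (≼-substˡ b₂≐b₁+1+1 (w² b₂≼n)) (w² below) (w² mid)
          (replace³ (λ _ → deg0 B) (λ σ _ → sub-deg0 B σ) n (w² a₂≐a₁) b₂≐b₁+1+1 (w² above))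

    main : Γ⁺ ⊢ ⊥'
    -- Which endpoint has colour 0 is not determined, so `no-path` is applied in both orders.
    main = taut (odd Y n a₁ b₁ ∷ odd Y n a₂ b₂ ∷ [])
      ((¬ᵖ (# 0) ⇒ᵖ # 1 ⇒ᵖ ⊥ᵖ) ⇒ᵖ (¬ᵖ (# 1) ⇒ᵖ # 0 ⇒ᵖ ⊥ᵖ) ⇒ᵖ (# 0 xorᵖ # 1) ⇒ᵖ ⊥ᵖ)
      ∙ no-path n R Y a₁ b₁ a₂ b₂ colour-right colour-up (w² edges) (w² a₁≼n) (w² b₁≼n) (w² end₁) (w² end₂)
          (λ a b → w² (even-R a b))
      ∙ no-path n R Y a₂ b₂ a₁ b₁ colour-right colour-up (w² edges) (w² a₂≼n) (w² b₂≼n) (w² end₂) (w² end₁)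
          (λ a b → w² (⇒I (⇒I (⇒I (⇒I (w³ (w (even-R a b)) ∙ h3 ∙ h2 ∙ h0 ∙ h1))))))
      ∙ opposite

-- Unpacking the hypotheses of the formal statement

curve-even : ∀ n B → Γ ⊢ curve n B → ∀ a b → Γ ⊢ (a ≼ n) ⇒ (b ≼ n) ⇒ even B a b
curve-even n B d a b = ⇒I (⇒I (conv
  (cong₂ _∨'_ (sub-deg0 B (inst² a b) (var 1) (var 0)) (sub-deg2 B (inst² a b) (var 1) (var 0)))
  (∀²E n (even B (var 1) (var 0)) (w² (∧E₂ d)) h1 h0)))

connects-even : ∀ n R a₁ b₁ a₂ b₂ → Γ ⊢ connects n R a₁ b₁ a₂ b₂ → ∀ a b → Γ ⊢ (a ≼ n) ⇒ (b ≼ n) ⇒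
  ¬' ((a ≐ a₁) ∧' (b ≐ b₁)) ⇒ ¬' ((a ≐ a₂) ∧' (b ≐ b₂)) ⇒ even R a b
connects-even n R a₁ b₁ a₂ b₂ d a b = ⇒I (⇒I (⇒I (⇒I (conv
  (cong₂ _⇒_
    (cong₂ (λ p q → ¬' p ∧' ¬' q)
      (cong₂ (λ y z → (a ≐ y) ∧' (b ≐ z)) (inst²-↑↑ a b a₁) (inst²-↑↑ a b b₁))
      (cong₂ (λ y z → (a ≐ y) ∧' (b ≐ z)) (inst²-↑↑ a b a₂) (inst²-↑↑ a b b₂)))
    (cong₂ _∨'_ (sub-deg0 R (inst² a b) (var 1) (var 0)) (sub-deg2 R (inst² a b) (var 1) (var 0))))
  (∀²E n
    ((¬' ((var 1 ≐ ↑ (↑ a₁)) ∧' (var 0 ≐ ↑ (↑ b₁))) ∧' ¬' ((var 1 ≐ ↑ (↑ a₂)) ∧' (var 0 ≐ ↑ (↑ b₂)))) ⇒ even R (var 1) (var 0))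
    (w² (w² (∧E₂ (∧E₂ d)))) h3 h2)
  ∙ ∧I h1 h0))))

disjoint-degrees : ∀ n B R → Γ ⊢ ¬' (intersect n B R) → ∀ a b →
  Γ ⊢ (a ≼ n) ⇒ (b ≼ n) ⇒ ¬' (degPos B a b ∧' degPos R a b)
disjoint-degrees n B R d a b = ⇒I (⇒I (⇒I (w³ d ∙
  ∃²I n (degPos B (var 1) (var 0) ∧' degPos R (var 1) (var 0)) a b h2 h1
    (conv (sym (cong₂ _∧'_ (sub-degPos B (inst² a b) (var 1) (var 0)) (sub-degPos R (inst² a b) (var 1) (var 0)))) h0))))

jordan : ∀ n B R a₁ b₁ a₂ b₂ → Γ ⊢ curve n B → Γ ⊢ diffSides n B a₁ b₁ a₂ b₂ → Γ ⊢ edgeSet n R →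
  Γ ⊢ connects n R a₁ b₁ a₂ b₂ → Γ ⊢ intersect n B R
jordan n B R a₁ b₁ a₂ b₂ curve-B sides edges conn = raa (∨E (w vertical)
  (disjoint⇒⊥ n B R a₁ b₁ a₂ b₂ (w² a₁≼n) (w² b₁≼n) (w² a₂≼n) (w² b₂≼n)
    (≐-sym (w² a₁≐a₂)) (∧E₁ h0) (w² deg-p₁) (∧E₂ h0) (w² deg-p₂)
    (w² edges) (w² (∧E₁ conn)) (w² (∧E₁ (∧E₂ conn)))
    (curve-even n B (w² curve-B)) (connects-even n R a₁ b₁ a₂ b₂ (w² conn)) (disjoint-degrees n B R h1))
  (disjoint⇒⊥ n B R a₂ b₂ a₁ b₁ (w² a₂≼n) (w² b₂≼n) (w² a₁≼n) (w² b₁≼n)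
    (w² a₁≐a₂) (∧E₁ h0) (w² deg-p₂)
    -- `diffSides` places the middle point in column `a₁` in either case, so its degree is
    -- transported to the equal column `a₂`.
    (replace³ (λ _ → deg2 B) (λ σ _ → sub-deg2 B σ) n (w² a₁≐a₂) ≐-refl (∧E₂ h0)) (w² deg-p₁)
    (w² edges) (w² (∧E₁ (∧E₂ conn))) (w² (∧E₁ conn))
    (curve-even n B (w² curve-B))
    (λ a b → ⇒I (⇒I (⇒I (⇒I (w³ (w (connects-even n R a₁ b₁ a₂ b₂ (w² conn) a b)) ∙ h3 ∙ h2 ∙ h0 ∙ h1)))))
    (disjoint-degrees n B R h1)))
  where
  a₁≼n = ∧E₁ sides
  b₁≼n = ∧E₁ (∧E₂ sides)
  a₂≼n = ∧E₁ (∧E₂ (∧E₂ sides))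
  b₂≼n = ∧E₁ (∧E₂ (∧E₂ (∧E₂ sides)))
  a₁≐a₂ = ∧E₁ (∧E₂ (∧E₂ (∧E₂ (∧E₂ sides))))
  vertical = ∧E₁ (∧E₂ (∧E₂ (∧E₂ (∧E₂ (∧E₂ sides)))))
  deg-p₁ = ∧E₁ (∧E₂ (∧E₂ (∧E₂ (∧E₂ (∧E₂ (∧E₂ sides))))))
  deg-p₂ = ∧E₂ (∧E₂ (∧E₂ (∧E₂ (∧E₂ (∧E₂ (∧E₂ sides))))))

mainTheorem1 : V⁰2⊢ jordanGrid
mainTheorem1 = ∀₂I (∀₂I (∀₁I (∀₁I (∀₁I (∀₁I (∀₁I (⇒I
  (jordan (var 4) 1 0 (var 3) (var 2) (var 1) (var 0)
    (∧E₁ (∧E₂ h0)) (∧E₁ (∧E₂ (∧E₂ h0))) (∧E₁ (∧E₂ (∧E₂ (∧E₂ h0)))) (∧E₂ (∧E₂ (∧E₂ (∧E₂ h0))))))))))))
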